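{- For every integer $r\ge 3$ there is a constant $c_r>0$ such that every $K_r$-free graph $G$ with $m$ edges satisfies $\mathrm{sp}(G)\ge c_r\, m^{\frac12+\frac{3}{4r-2}}$.
   Context: All graphs are finite and simple. A graph is $K_r$-free if it has no complete subgraph on $r$ vertices. $\mathrm{mc}(G)$ denotes the maximum number of edges crossing a partition of $V(G)$ into two parts, and $\mathrm{sp}(G)=\mathrm{mc}(G)-e(G)/2$. -}

module Defs where

open import Data.Nat using (ℕ; zero; suc; _+_; _<ᵇ_; _⊔_)
open import Data.Bool using (Bool; true; false; _∧_; _xor_; if_then_else_)
open import Data.Fin using (Fin; toℕ)
open import Data.List using (List; []; _∷_; map; concatMap; allFin; foldr)
open import Data.Vec using (Vec; lookup) renaming ([] to []ᵥ; _∷_ to _∷ᵥ_)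
open import Data.Product using (Σ; _×_; _,_)
open import Relation.Binary.PropositionalEquality using (_≡_; _≢_)
open import Relation.Nullary using (¬_)

record Graph (n : ℕ) : Set where
  field
    adj    : Fin n → Fin n → Bool
    sym    : ∀ i j → adj i j ≡ adj j i
    irrefl : ∀ i → adj i i ≡ false
open Graph public

countT : List Bool → ℕ
countT []           = 0
countT (true ∷ bs)  = suc (countT bs)
countT (false ∷ bs) = countT bs

pairs : (n : ℕ) → List (Fin n × Fin n)
pairs n = concatMap (λ i → map (λ j → (i , j)) (allFin n)) (allFin n)

e : ∀ {n} → Graph n → ℕ
e {n} G = countT (map (λ { (i , j) → (toℕ i <ᵇ toℕ j) ∧ adj G i j }) (pairs n))

cut : ∀ {n} → Graph n → Vec Bool n → ℕ
cut {n} G S = countT (map (λ { (i , j) → (toℕ i <ᵇ toℕ j) ∧ adj G i j ∧ (lookup S i xor lookup S j) }) (pairs n))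

allVecs : (n : ℕ) → List (Vec Bool n)
allVecs zero    = []ᵥ ∷ []
allVecs (suc n) = concatMap (λ v → (true ∷ᵥ v) ∷ (false ∷ᵥ v) ∷ []) (allVecs n)

mc : ∀ {n} → Graph n → ℕ
mc {n} G = foldr _⊔_ 0 (map (cut G) (allVecs n))

KFree : (r : ℕ) → ∀ {n} → Graph n → Set
KFree r {n} G = ¬ (Σ (Fin r → Fin n) λ f → ∀ i j → i ≢ j → adj G (f i) (f j) ≡ true)

{-# OPTIONS --safe #-}
module Submission where

-- Write r = ρ + 2. The surplus dominates -Σ_{uv ∈ E} x_u x_v for every x in [-1,1]^V, since this form is affine in each
-- coordinate; hence it dominates the expectation of the form for a random x.
--
-- Two lower bounds are proved by induction on ρ, passing from G to disjoint subsets of neighbourhoods, which are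
-- K_{r-1}-free. If every v has a set B v of at most s^(r-1) neighbours, then Σ |B v| is at most s^(r-2) sp(G) up to
-- constants (sparse-bound): take x_v = s_v - f(Σ_{w ∈ B v} s_w) with random signs s and an odd f, chosen as a sine so that
-- all correlations are explicit products. If G has density above 1/q, then e(G) is at most q^(r-2) sp(G) up to constants
-- (dense-bound): O(q) disjoint neighbourhoods receive random signs, and all other vertices the opposite of the average sign.
--
-- Choose s with s^(2r-1) about e(G). The edges at vertices of degree at most s^(r-1) are bounded by the first estimate, and
-- the at most O(s^r) remaining vertices by the second one with q about s. Either way e(G) is at most s^(r-2) sp(G) up to
-- constants, and s^(2r-1) ≤ e(G) turns this into the claimed power.

open import Defs using (Graph; KFree; adj; irrefl; countT; pairs; e; cut; allVecs; mc)
open import Algebra.Bundles using (CommutativeRing)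
open import Data.Bool using (Bool; true; false; _∧_; _xor_; not; if_then_else_)
open import Data.Bool.Properties using (∧-comm)
open import Data.Empty using (⊥-elim)
open import Data.Fin as Fin using (Fin; zero; suc; toℕ)
open import Data.Fin.Properties using (toℕ-injective)
open import Data.Integer using (ℤ; +_; -_; _+_; _*_; _-_; _≤_; _<_; -[1+_]; 0ℤ; 1ℤ; -1ℤ; +≤+; -≤+; +<+; _≤?_)
open import Data.Integer.Properties
open import Data.Integer.Tactic.RingSolver using (solve-∀)
open import Data.List using ([]; _∷_; _++_; map; concatMap; foldr; tabulate; allFin)
open import Data.List.Membership.Propositional using (_∈_)
open import Data.List.Membership.Propositional.Properties using (∈-concatMap⁺)
open import Data.List.Properties using (map-++; map-tabulate)
open import Data.List.Relation.Unary.Any using (Any; here; there)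
open import Data.Nat as ℕ using (ℕ; zero; suc; _<ᵇ_; _⊔_)
import Data.Nat.Properties as ℕ
import Data.Nat.Tactic.RingSolver as ℕSolver
open import Data.Product using (Σ; ∃; _×_; _,_; proj₁; proj₂)
open import Data.Sum using (_⊎_; inj₁; inj₂)
open import Data.Vec using (Vec; []; _∷_; lookup)
open import Function using (_∘_)
open import Relation.Binary.PropositionalEquality
open import Relation.Nullary using (Dec; yes; no; does)
open import Algebra.Properties.Semiring.Sum (CommutativeRing.semiring +-*-commutativeRing)
  using (sum; sum-cong-≗; ∑-distrib-+; ∑-comm; *-distribˡ-sum; *-distribʳ-sum; sum-replicate-zero)

-- The exponent comes from a balance. Both estimates lose the same power: the sparse one loses
-- s^(r-2), and the dense one loses q^(r-1) / q with q of order s. There are at most 2 e(G) /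
-- s^(r-1) vertices of large degree, and the square of their number has to stay below a fraction of
-- q e(G) for the error term of the dense estimate to be absorbed. This allows e(G) up to order
-- s^(2r-1) and no more. In the sparse estimate the obstacle is that responding vertices may be
-- adjacent. A response by an angle θ earns about sin θ for each pair in B, but an edge u v costs
-- about sin² θ for each common element of B u and B v. With θ of order 1/K this is affordable at K
-- conflicts per pair. A pair with more conflicts lies in many triangles, and these supply the edges
-- for the induction inside neighbourhoods. No division occurs: cubes are scaled, expectations are
-- plain sums over all sign vectors, and θ is the angle of a Pythagorean triple.

-- Inequalities between integers are derived from ring identities: y - x is exhibited as a manifestly nonnegative expression.
by-diff : ∀ {x y} d → y - x ≡ d → 0ℤ ≤ d → x ≤ y
by-diff d eq 0≤d = 0≤i-j⇒j≤i (subst (0ℤ ≤_) (sym eq) 0≤d)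

diff : ∀ {x y} → x ≤ y → 0ℤ ≤ y - x
diff = i≤j⇒0≤j-i

0≤+ : ∀ {x y} → 0ℤ ≤ x → 0ℤ ≤ y → 0ℤ ≤ x + y
0≤+ = +-mono-≤

0≤* : ∀ {x y} → 0ℤ ≤ x → 0ℤ ≤ y → 0ℤ ≤ x * y
0≤* {+ a} {+ b} _ _ = subst (0ℤ ≤_) (pos-* a b) (+≤+ ℕ.z≤n)

0≤+ℕ : ∀ {n} → 0ℤ ≤ + n
0≤+ℕ = +≤+ ℕ.z≤n

*-monoˡ : ∀ {c x y} → 0ℤ ≤ c → x ≤ y → c * x ≤ c * y
*-monoˡ {c} {x} {y} 0≤c x≤y = by-diff (c * (y - x)) (eq c x y) (0≤* 0≤c (diff x≤y))
  where
  eq : ∀ c x y → c * y - c * x ≡ c * (y - x)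
  eq = solve-∀


*-cancelˡ-nonneg : ∀ {c x} → 0ℤ < c → 0ℤ ≤ c * x → 0ℤ ≤ x
*-cancelˡ-nonneg {+ suc c} {x} (+<+ _) 0≤cx =
  *-cancelˡ-≤-pos 0ℤ x (+ suc c) (subst (_≤ + suc c * x) (sym (*-zeroʳ (+ suc c))) 0≤cx)

*-cancelˡ-≤ : ∀ {c x y} → 0ℤ < c → c * x ≤ c * y → x ≤ y
*-cancelˡ-≤ {+ suc c} {x} {y} (+<+ _) = *-cancelˡ-≤-pos x y (+ suc c)

-- Finite sums of integers and indicators

sum-nonneg : ∀ {n} {f : Fin n → ℤ} → (∀ i → 0ℤ ≤ f i) → 0ℤ ≤ sum f
sum-nonneg {zero} _ = ≤-refl
sum-nonneg {suc n} 0≤f = +-mono-≤ (0≤f zero) (sum-nonneg (0≤f ∘ suc))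

sum-mono : ∀ {n} {f g : Fin n → ℤ} → (∀ i → f i ≤ g i) → sum f ≤ sum g
sum-mono {zero} _ = ≤-refl
sum-mono {suc n} f≤g = +-mono-≤ (f≤g zero) (sum-mono (f≤g ∘ suc))

sum-const : ∀ n c → sum {n} (λ _ → c) ≡ + n * c
sum-const zero c = sym (*-zeroˡ c)
sum-const (suc n) c = trans (cong (_+_ c) (sum-const n c)) (sym (suc-* (+ n) c))

-- This serves as the averaging principle: good vertices and colours are found by giving a suitable
-- auxiliary function a positive total.
sum-positive : ∀ {n} {f : Fin n → ℤ} → 0ℤ < sum f → ∃ λ i → 0ℤ < f i
sum-positive {zero} (+<+ ())
sum-positive {suc n} {f} 0<s with 0ℤ <? f zero
... | yes 0<f = zero , 0<f
... | no ¬0<f with sum-positive {n} {f ∘ suc} (<-≤-trans 0<s (by-diff _ (eq (f zero) (sum (f ∘ suc))) (diff (≮⇒≥ ¬0<f))))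
  where
  eq : ∀ a b → b - (a + b) ≡ 0ℤ - a
  eq = solve-∀
... | i , 0<fi = suc i , 0<fi

sum-+ : ∀ {n} (f g : Fin n → ℤ) → sum (λ i → f i + g i) ≡ sum f + sum g
sum-+ = ∑-distrib-+

sum-*ˡ : ∀ {n} c (f : Fin n → ℤ) → sum (λ i → c * f i) ≡ c * sum f
sum-*ˡ c f = sym (*-distribˡ-sum c f)

sum-*ʳ : ∀ {n} c (f : Fin n → ℤ) → sum (λ i → f i * c) ≡ sum f * c
sum-*ʳ c f = sym (*-distribʳ-sum c f)

sum-zero : ∀ {n} {f : Fin n → ℤ} → (∀ i → f i ≡ 0ℤ) → sum f ≡ 0ℤ
sum-zero {n} f≡0 = trans (sum-cong-≗ f≡0) (sum-replicate-zero n)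

sum₂-cong : ∀ {m n} {f g : Fin m → Fin n → ℤ} → (∀ i j → f i j ≡ g i j) →
  sum (λ i → sum (f i)) ≡ sum (λ i → sum (g i))
sum₂-cong eq = sum-cong-≗ λ i → sum-cong-≗ (eq i)

sum₂-mono : ∀ {m n} {f g : Fin m → Fin n → ℤ} → (∀ i j → f i j ≤ g i j) →
  sum (λ i → sum (f i)) ≤ sum (λ i → sum (g i))
sum₂-mono le = sum-mono λ i → sum-mono (le i)

sum₂-+ : ∀ {m n} (f g : Fin m → Fin n → ℤ) →
  sum (λ i → sum (λ j → f i j + g i j)) ≡ sum (λ i → sum (f i)) + sum (λ i → sum (g i))
sum₂-+ f g = trans (sum-cong-≗ λ i → sum-+ (f i) (g i)) (sum-+ (λ i → sum (f i)) (λ i → sum (g i)))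

sum₂-*ˡ : ∀ {m n} c (f : Fin m → Fin n → ℤ) →
  sum (λ i → sum (λ j → c * f i j)) ≡ c * sum (λ i → sum (f i))
sum₂-*ˡ c f = trans (sum-cong-≗ λ i → sum-*ˡ c (f i)) (sum-*ˡ c (λ i → sum (f i)))

ι : Bool → ℤ
ι true = 1ℤ
ι false = 0ℤ

ι-∧ : ∀ a b → ι (a ∧ b) ≡ ι a * ι b
ι-∧ true b = sym (*-identityˡ (ι b))
ι-∧ false b = sym (*-zeroˡ (ι b))

0≤ι : ∀ b → 0ℤ ≤ ι b
0≤ι true = +≤+ ℕ.z≤n
0≤ι false = ≤-refl

ι≤1 : ∀ b → ι b ≤ 1ℤ
ι≤1 true = ≤-refl
ι≤1 false = +≤+ ℕ.z≤n

ι-mono : ∀ {a b} → (a ≡ true → b ≡ true) → ι a ≤ ι b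
ι-mono {false} {b} _ = 0≤ι b
ι-mono {true} imp rewrite imp refl = ≤-refl

-- Surplus and rounding

sgn : Bool → ℤ
sgn true = 1ℤ
sgn false = -1ℤ

signs : ∀ {n} → Vec Bool n → Fin n → ℤ
signs s i = sgn (lookup s i)

quad : ∀ {n} → Graph n → (Fin n → ℤ) → ℤ
quad G x = sum λ u → sum λ v → ι (adj G u v) * (x u * x v)

-- Since quad G (signs s) = 2 (e(G) - 2 cut(s)), this says that the surplus of G is at most T / 4.
Surplus≤ : ∀ {n} → Graph n → ℤ → Set
Surplus≤ {n} G T = (s : Vec Bool n) → 0ℤ ≤ T + quad G (signs s)

Bounded : ℤ → ℤ → Set
Bounded L x = - L ≤ x × x ≤ L

-- The constant and linear terms are there for the induction: fixing one coordinate of a quadratic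
-- form leaves such terms behind.
form : ∀ {n} → ℤ → (Fin n → ℤ) → (Fin n → Fin n → ℤ) → (Fin n → ℤ) → ℤ
form c b M x = c + sum (λ i → b i * x i) + sum (λ i → sum λ j → M i j * (x i * x j))

form-shift : ∀ {n} c b M (x : Fin n → ℤ) d (m : Fin n → ℤ) y →
  form (c + d * y) (λ i → b i + m i * y) M x ≡ form c b M x + y * (d + sum λ i → m i * x i)
form-shift c b M x d m y = begin
  c + d * y + sum (λ i → (b i + m i * y) * x i) + q
    ≡⟨ cong (λ z → c + d * y + z + q) (trans (sum-cong-≗ λ i → step (b i) (m i) y (x i))
         (trans (sum-+ (λ i → b i * x i) (λ i → y * (m i * x i)))
           (cong (_+_ (sum λ i → b i * x i)) (sum-*ˡ y (λ i → m i * x i))))) ⟩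
  c + d * y + (sum (λ i → b i * x i) + y * sum (λ i → m i * x i)) + q
    ≡⟨ regroup c d y (sum λ i → b i * x i) (sum λ i → m i * x i) q ⟩
  form c b M x + y * (d + sum λ i → m i * x i) ∎
  where
  open ≡-Reasoning
  q = sum (λ i → sum λ j → M i j * (x i * x j))
  step : ∀ b m y x → (b + m * y) * x ≡ b * x + y * (m * x)
  step = solve-∀
  regroup : ∀ c d y p r q → c + d * y + (p + y * r) + q ≡ c + p + q + y * (d + r)
  regroup = solve-∀

-- The vanishing diagonal entry removes the square of the first coordinate, so the form is affine in
-- it.
form-suc : ∀ {n} c b M (x : Fin (suc n) → ℤ) → M zero zero ≡ 0ℤ →
  form c b M x ≡ form (c + b zero * x zero)
    (λ i → b (suc i) + (M zero (suc i) + M (suc i) zero) * x zero)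
    (λ i j → M (suc i) (suc j)) (x ∘ suc)
form-suc {n} c b M x M₀₀≡0 = begin
  c + (b zero * y + B) + (M zero zero * (y * y) + R + sum (λ i → M (suc i) zero * (x (suc i) * y) + N i))
    ≡⟨ cong₂ (λ p r → c + (b zero * y + B) + (p * (y * y) + R + r)) M₀₀≡0
         (sum-+ (λ i → M (suc i) zero * (x (suc i) * y)) N) ⟩
  c + (b zero * y + B) + (0ℤ * (y * y) + R + (C + sum N))
    ≡⟨ regroup c (b zero) y B R C (sum N) ⟩
  (c + B + sum N) + (y * b zero + (R + C))
    ≡⟨ cong (λ z → (c + B + sum N) + (y * b zero + z)) R+C ⟩
  (c + B + sum N) + (y * b zero + y * sum (λ i → m i * x (suc i)))
    ≡⟨ cong (_+_ (c + B + sum N)) (sym (*-distribˡ-+ y (b zero) (sum (λ i → m i * x (suc i))))) ⟩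
  (c + B + sum N) + y * (b zero + sum (λ i → m i * x (suc i)))
    ≡⟨ sym (form-shift c (b ∘ suc) (λ i j → M (suc i) (suc j)) (x ∘ suc) (b zero) m y) ⟩
  _ ∎
  where
  open ≡-Reasoning
  y = x zero
  m : Fin n → ℤ
  m i = M zero (suc i) + M (suc i) zero
  B = sum λ i → b (suc i) * x (suc i)
  R = sum λ i → M zero (suc i) * (y * x (suc i))
  C = sum λ i → M (suc i) zero * (x (suc i) * y)
  N : Fin n → ℤ
  N i = sum λ j → M (suc i) (suc j) * (x (suc i) * x (suc j))
  term : ∀ p q y x → p * (y * x) + q * (x * y) ≡ y * ((p + q) * x)
  term = solve-∀
  R+C : R + C ≡ y * sum (λ i → m i * x (suc i))
  R+C = trans (sym (sum-+ (λ i → M zero (suc i) * (y * x (suc i))) (λ i → M (suc i) zero * (x (suc i) * y))))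
    (trans (sum-cong-≗ λ i → term (M zero (suc i)) (M (suc i) zero) y (x (suc i)))
      (sum-*ˡ y (λ i → m i * x (suc i))))
  regroup : ∀ c b y B R C N → c + (b * y + B) + (0ℤ * (y * y) + R + (C + N)) ≡ (c + B + N) + (y * b + (R + C))
  regroup = solve-∀

-- Multiplied by 2 L, the value at x is the combination of the values at L and -L with the
-- nonnegative weights x + L and L - x.
affine-nonneg : ∀ {L x} P R → 0ℤ < L → Bounded L x → 0ℤ ≤ P + L * R → 0ℤ ≤ P + (- L) * R → 0ℤ ≤ P + x * R
affine-nonneg {L} {x} P R 0<L (-L≤x , x≤L) h₊ h₋ = *-cancelˡ-nonneg 0<L (*-cancelˡ-nonneg {+ 2} (+<+ (ℕ.s≤s ℕ.z≤n))
  (subst (0ℤ ≤_) (sym (eq L x P R)) (0≤+ (0≤* (diff -L≤x) h₊) (0≤* (diff x≤L) h₋))))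
  where
  eq : ∀ L x P R → + 2 * (L * (P + x * R)) ≡ (x - (- L)) * (P + L * R) + (L - x) * (P + (- L) * R)
  eq = solve-∀

form-extreme : ∀ {n} L c b M → 0ℤ < L → (∀ i → M i i ≡ 0ℤ) →
  (∀ (s : Vec Bool n) → 0ℤ ≤ form c b M (λ i → L * signs s i)) →
  ∀ x → (∀ i → Bounded L (x i)) → 0ℤ ≤ form c b M x
form-extreme {zero} L c b M 0<L _ vertices x _ = vertices []
form-extreme {suc n} L c b M 0<L diag vertices x bound =
  subst (0ℤ ≤_) (sym (trans (form-suc c b M x (diag zero)) (shift (x zero))))
    (affine-nonneg P R 0<L (bound zero)
      (subst (0ℤ ≤_) (shift L) (face true (*-identityʳ L)))
      (subst (0ℤ ≤_) (shift (- L)) (face false (neg L))))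
  where
  m : Fin n → ℤ
  m i = M zero (suc i) + M (suc i) zero
  M′ : Fin n → Fin n → ℤ
  M′ i j = M (suc i) (suc j)
  P = form c (b ∘ suc) M′ (x ∘ suc)
  R = b zero + sum (λ i → m i * x (suc i))
  shift : ∀ y → form (c + b zero * y) (λ i → b (suc i) + m i * y) M′ (x ∘ suc) ≡ P + y * R
  shift y = form-shift c (b ∘ suc) M′ (x ∘ suc) (b zero) m y
  neg : ∀ L → L * -1ℤ ≡ - L
  neg = solve-∀
  face : ∀ σ {y} → L * sgn σ ≡ y →
    0ℤ ≤ form (c + b zero * y) (λ i → b (suc i) + m i * y) M′ (x ∘ suc)
  face σ refl = form-extreme L (c + b zero * (L * sgn σ)) (λ i → b (suc i) + m i * (L * sgn σ)) M′ 0<L (diag ∘ suc)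
    (λ s → subst (0ℤ ≤_) (form-suc c b M (λ i → L * signs (σ ∷ s) i) (diag zero)) (vertices (σ ∷ s)))
    (x ∘ suc) (bound ∘ suc)

-- Scaling the cube to [-L, L] replaces rational vectors in [-1, 1] by integral ones. At its
-- vertices the form is `L * L` times that of a cut.
rounding : ∀ {n} (G : Graph n) {T} L x → Surplus≤ G T → 0ℤ < L → (∀ v → Bounded L (x v)) →
  0ℤ ≤ L * L * T + quad G x
rounding {n} G {T} L x surplus 0<L bound =
  subst (0ℤ ≤_) (form-quad x) (form-extreme L (L * L * T) (λ _ → 0ℤ) M 0<L (λ i → cong ι (irrefl G i)) vertices x bound)
  where
  M : Fin n → Fin n → ℤ
  M u v = ι (adj G u v)
  drop : ∀ a q → a + 0ℤ + q ≡ a + q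
  drop = solve-∀
  form-quad : ∀ x → form (L * L * T) (λ _ → 0ℤ) M x ≡ L * L * T + quad G x
  form-quad x = trans (cong (λ z → L * L * T + z + quad G x) (sum-zero {n} λ i → *-zeroˡ (x i))) (drop (L * L * T) (quad G x))
  scale : ∀ L a x y → a * (L * x * (L * y)) ≡ L * L * (a * (x * y))
  scale = solve-∀
  vertices : ∀ s → 0ℤ ≤ form (L * L * T) (λ _ → 0ℤ) M (λ i → L * signs s i)
  vertices s = subst (0ℤ ≤_) (sym (trans (form-quad (λ i → L * signs s i))
      (trans (cong (_+_ (L * L * T)) (trans (sum₂-cong λ u v → scale L (M u v) (signs s u) (signs s v))
          (sum₂-*ˡ (L * L) (λ u v → M u v * (signs s u * signs s v)))))
        (sym (*-distribˡ-+ (L * L) T (quad G (signs s)))))))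
    (0≤* (0≤* (<⇒≤ 0<L) (<⇒≤ 0<L)) (surplus s))

-- Random signs

-- An unnormalised expectation: the sum over all 2^n sign vectors, with `∣Ω∣ n` as the total mass.
-- The first sign is summed out innermost, so factorisations over the coordinates reduce to a
-- pointwise identity in one sign.
𝔼 : ∀ n → (Vec Bool n → ℤ) → ℤ
𝔼 zero f = f []
𝔼 (suc n) f = 𝔼 n λ s → f (true ∷ s) + f (false ∷ s)

𝔼-cong : ∀ n {f g : Vec Bool n → ℤ} → (∀ s → f s ≡ g s) → 𝔼 n f ≡ 𝔼 n g
𝔼-cong zero eq = eq []
𝔼-cong (suc n) eq = 𝔼-cong n λ s → cong₂ _+_ (eq (true ∷ s)) (eq (false ∷ s))

𝔼-nonneg : ∀ n {f : Vec Bool n → ℤ} → (∀ s → 0ℤ ≤ f s) → 0ℤ ≤ 𝔼 n f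
𝔼-nonneg zero 0≤f = 0≤f []
𝔼-nonneg (suc n) 0≤f = 𝔼-nonneg n λ s → 0≤+ (0≤f (true ∷ s)) (0≤f (false ∷ s))

𝔼-+ : ∀ n (f g : Vec Bool n → ℤ) → 𝔼 n (λ s → f s + g s) ≡ 𝔼 n f + 𝔼 n g
𝔼-+ zero f g = refl
𝔼-+ (suc n) f g = trans
  (𝔼-cong n λ s → interchange (f (true ∷ s)) (g (true ∷ s)) (f (false ∷ s)) (g (false ∷ s)))
  (𝔼-+ n _ _)
  where
  interchange : ∀ a b c d → a + b + (c + d) ≡ (a + c) + (b + d)
  interchange = solve-∀

𝔼-*ˡ : ∀ n c (f : Vec Bool n → ℤ) → 𝔼 n (λ s → c * f s) ≡ c * 𝔼 n f
𝔼-*ˡ zero c f = refl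
𝔼-*ˡ (suc n) c f = trans
  (𝔼-cong n λ s → sym (*-distribˡ-+ c (f (true ∷ s)) (f (false ∷ s))))
  (𝔼-*ˡ n c _)

∣Ω∣ : ℕ → ℤ
∣Ω∣ n = 𝔼 n (λ _ → 1ℤ)

𝔼-const : ∀ n c → 𝔼 n (λ _ → c) ≡ c * ∣Ω∣ n
𝔼-const n c = trans (𝔼-cong n λ _ → sym (*-identityʳ c)) (𝔼-*ˡ n c (λ _ → 1ℤ))

∣Ω∣-suc : ∀ n → ∣Ω∣ (suc n) ≡ + 2 * ∣Ω∣ n
∣Ω∣-suc n = 𝔼-const n (+ 2)

∣Ω∣-positive : ∀ n → 0ℤ < ∣Ω∣ n
∣Ω∣-positive zero = +<+ (ℕ.s≤s ℕ.z≤n)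
∣Ω∣-positive (suc n) = subst (0ℤ <_) (sym (∣Ω∣-suc n)) (*-monoˡ-<-pos (+ 2) (∣Ω∣-positive n))

𝔼-sum : ∀ n {m} (f : Fin m → Vec Bool n → ℤ) → 𝔼 n (λ s → sum λ i → f i s) ≡ sum (λ i → 𝔼 n (f i))
𝔼-sum n {zero} f = trans (𝔼-const n 0ℤ) (*-zeroˡ (∣Ω∣ n))
𝔼-sum n {suc m} f = trans (𝔼-+ n (f zero) _) (cong (_+_ (𝔼 n (f zero))) (𝔼-sum n (f ∘ suc)))

𝔼-quad : ∀ {n} t (G : Graph n) (x : Vec Bool t → Fin n → ℤ) →
  𝔼 t (λ s → quad G (x s)) ≡ sum λ u → sum λ v → ι (adj G u v) * 𝔼 t (λ s → x s u * x s v)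
𝔼-quad t G x = trans (𝔼-sum t (λ u s → sum λ v → ι (adj G u v) * (x s u * x s v))) (sum-cong-≗ λ u →
  trans (𝔼-sum t (λ v s → ι (adj G u v) * (x s u * x s v))) (sum-cong-≗ λ v → 𝔼-*ˡ t (ι (adj G u v)) _))

signs-orthogonal : ∀ t (α β : Fin t → ℤ) →
  𝔼 t (λ s → sum (λ i → α i * signs s i) * sum (λ i → β i * signs s i)) ≡ ∣Ω∣ t * sum (λ i → α i * β i)
signs-orthogonal zero α β = refl
signs-orthogonal (suc t) α β = begin
  𝔼 t (λ s → (α zero * 1ℤ + A s) * (β zero * 1ℤ + B s) + (α zero * -1ℤ + A s) * (β zero * -1ℤ + B s))
    ≡⟨ 𝔼-cong t (λ s → expand (α zero) (β zero) (A s) (B s)) ⟩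
  𝔼 t (λ s → + 2 * (α zero * β zero) + + 2 * (A s * B s))
    ≡⟨ trans (𝔼-+ t _ _) (cong₂ _+_ (𝔼-const t (+ 2 * (α zero * β zero))) (𝔼-*ˡ t (+ 2) (λ s → A s * B s))) ⟩
  + 2 * (α zero * β zero) * ∣Ω∣ t + + 2 * 𝔼 t (λ s → A s * B s)
    ≡⟨ cong (λ z → + 2 * (α zero * β zero) * ∣Ω∣ t + + 2 * z) (signs-orthogonal t (α ∘ suc) (β ∘ suc)) ⟩
  + 2 * (α zero * β zero) * ∣Ω∣ t + + 2 * (∣Ω∣ t * C)
    ≡⟨ regroup (α zero * β zero) (∣Ω∣ t) C ⟩
  + 2 * ∣Ω∣ t * (α zero * β zero + C)
    ≡⟨ cong (_* (α zero * β zero + C)) (sym (∣Ω∣-suc t)) ⟩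
  ∣Ω∣ (suc t) * (α zero * β zero + C) ∎
  where
  open ≡-Reasoning
  A B : Vec Bool t → ℤ
  A s = sum λ i → α (suc i) * signs s i
  B s = sum λ i → β (suc i) * signs s i
  C = sum λ i → α (suc i) * β (suc i)
  expand : ∀ a b x y → (a * 1ℤ + x) * (b * 1ℤ + y) + (a * -1ℤ + x) * (b * -1ℤ + y) ≡ + 2 * (a * b) + + 2 * (x * y)
  expand = solve-∀
  regroup : ∀ p w c → + 2 * p * w + + 2 * (w * c) ≡ + 2 * w * (p + c)
  regroup = solve-∀

bounded-sum : ∀ {n} {f g : Fin n → ℤ} → (∀ i → Bounded (g i) (f i)) → Bounded (sum g) (sum f)
bounded-sum {zero} _ = ≤-refl , ≤-refl
bounded-sum {suc n} {f} {g} bound with bounded-sum {n} {f ∘ suc} {g ∘ suc} (bound ∘ suc)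
... | lo , hi = ≤-trans (≤-reflexive (neg-distrib-+ (g zero) _)) (+-mono-≤ (proj₁ (bound zero)) lo) ,
  +-mono-≤ (proj₂ (bound zero)) hi

bounded-mono : ∀ {L M x} → L ≤ M → Bounded L x → Bounded M x
bounded-mono L≤M (lo , hi) = ≤-trans (neg-mono-≤ L≤M) lo , ≤-trans hi L≤M

bounded-neg : ∀ {L x} → Bounded L x → Bounded L (- x)
bounded-neg {L} {x} (lo , hi) = neg-mono-≤ hi , ≤-trans (neg-mono-≤ lo) (≤-reflexive (neg-involutive L))

bounded-sgn : ∀ {L x} σ → Bounded L x → Bounded L (x * sgn σ)
bounded-sgn {L} {x} true = subst (Bounded L) (sym (*-identityʳ x))
bounded-sgn {L} {x} false b = subst (Bounded L) (eq x) (bounded-neg b)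
  where
  eq : ∀ x → - x ≡ x * -1ℤ
  eq = solve-∀

-- Projecting the vectors α v on a random sign vector turns products of coordinates into inner products.
gram-rounding : ∀ {n t} (G : Graph n) {T} L (α β : Fin n → Fin t → ℤ) → Surplus≤ G T → 0ℤ < L →
  (∀ v i → Bounded (β v i) (α v i)) → (∀ v → sum (β v) ≤ L) →
  0ℤ ≤ L * L * T + sum λ u → sum λ v → ι (adj G u v) * sum λ i → α u i * α v i
gram-rounding {n} {t} G {T} L α β surplus 0<L bound total =
  *-cancelˡ-nonneg (∣Ω∣-positive t) (subst (0ℤ ≤_) average (𝔼-nonneg t pointwise))
  where
  open ≡-Reasoning
  x : Vec Bool t → Fin n → ℤ
  x s v = sum λ i → α v i * signs s i
  pointwise : ∀ s → 0ℤ ≤ L * L * T + quad G (x s)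
  pointwise s = rounding G {T} L (x s) surplus 0<L λ v →
    bounded-mono (total v) (bounded-sum λ i → bounded-sgn (lookup s i) (bound v i))
  swap : ∀ a w c → a * (w * c) ≡ w * (a * c)
  swap = solve-∀
  average : 𝔼 t (λ s → L * L * T + quad G (x s)) ≡
    ∣Ω∣ t * (L * L * T + sum λ u → sum λ v → ι (adj G u v) * sum λ i → α u i * α v i)
  average = begin
    𝔼 t (λ s → L * L * T + quad G (x s))
      ≡⟨ 𝔼-+ t (λ _ → L * L * T) (λ s → quad G (x s)) ⟩
    𝔼 t (λ _ → L * L * T) + 𝔼 t (λ s → quad G (x s))
      ≡⟨ cong₂ _+_ (trans (𝔼-const t (L * L * T)) (*-comm (L * L * T) (∣Ω∣ t))) (trans (𝔼-quad t G x)
           (trans (sum₂-cong λ u v → trans (cong (ι (adj G u v) *_) (signs-orthogonal t (α u) (α v)))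
               (swap (ι (adj G u v)) (∣Ω∣ t) (sum λ i → α u i * α v i)))
             (sum₂-*ˡ (∣Ω∣ t) (λ u v → ι (adj G u v) * sum λ i → α u i * α v i)))) ⟩
    ∣Ω∣ t * (L * L * T) + ∣Ω∣ t * (sum λ u → sum λ v → ι (adj G u v) * sum λ i → α u i * α v i)
      ≡⟨ sym (*-distribˡ-+ (∣Ω∣ t) (L * L * T) _) ⟩
    _ ∎

-- The vertex set is kept and only edges are deleted, which avoids renaming vertices. Densities are
-- therefore measured against `size U` and never against n.
restrict : ∀ {n} → Graph n → (Fin n → Bool) → Graph n
restrict G U = record
  { adj = λ u v → adj G u v ∧ (U u ∧ U v)
  ; sym = λ u v → cong₂ _∧_ (Graph.sym G u v) (∧-comm (U u) (U v))
  ; irrefl = λ u → cong (_∧ (U u ∧ U u)) (irrefl G u)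
  }

minimizer : ∀ {n} (f : Vec Bool n → ℤ) → ∃ λ s → ∀ s′ → f s ≤ f s′
minimizer {zero} f = [] , λ { [] → ≤-refl }
minimizer {suc n} f with minimizer (λ s → f (true ∷ s)) | minimizer (λ s → f (false ∷ s))
... | s₁ , min₁ | s₂ , min₂ with f (true ∷ s₁) ≤? f (false ∷ s₂)
... | yes le = true ∷ s₁ , λ { (true ∷ s) → min₁ s ; (false ∷ s) → ≤-trans le (min₂ s) }
... | no gt = false ∷ s₂ , λ { (true ∷ s) → ≤-trans (<⇒≤ (≰⇒> gt)) (min₁ s) ; (false ∷ s) → min₂ s }

-- The zero vector, the mean of a uniformly random cut, is a point of the cube at which the form
-- vanishes.
surplus-nonneg : ∀ {n} (G : Graph n) {T} → Surplus≤ G T → 0ℤ ≤ T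
surplus-nonneg {n} G {T} surplus = subst (0ℤ ≤_)
  (trans (cong (_+_ (1ℤ * 1ℤ * T)) (sum-zero {n} λ u → sum-zero {n} λ v → *-zeroʳ (ι (adj G u v)))) (eq T))
  (rounding G {T} 1ℤ (λ _ → 0ℤ) surplus (+<+ (ℕ.s≤s ℕ.z≤n)) λ _ → -≤+ , +≤+ ℕ.z≤n)
  where
  eq : ∀ T → 1ℤ * 1ℤ * T + 0ℤ ≡ T
  eq = solve-∀

-- Optimal cuts of disjoint induced subgraphs are combined with independent random orientations.
disjoint-surplus : ∀ {n t} (G : Graph n) {T} (U : Fin t → Fin n → Bool) → Surplus≤ G T →
  (∀ v → sum (λ i → ι (U i v)) ≤ 1ℤ) →
  Σ (Fin t → ℤ) λ S → (∀ i → 0ℤ ≤ S i) × (∀ i → Surplus≤ (restrict G (U i)) (S i)) × sum S ≤ T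
disjoint-surplus {n} {t} G {T} U surplus disjoint = S , (λ i → surplus-nonneg (restrict G (U i)) {S i} (opt i)) , opt , total
  where
  best : ∀ i → ∃ λ s → ∀ s′ → quad (restrict G (U i)) (signs s) ≤ quad (restrict G (U i)) (signs s′)
  best i = minimizer λ s → quad (restrict G (U i)) (signs s)
  y : Fin t → Fin n → ℤ
  y i = signs (proj₁ (best i))
  S : Fin t → ℤ
  S i = - quad (restrict G (U i)) (y i)
  opt : ∀ i → Surplus≤ (restrict G (U i)) (S i)
  opt i s = subst (0ℤ ≤_) (+-comm _ (S i)) (diff (proj₂ (best i) s))
  -- A vertex of part i goes to plus or minus the i-th basis vector. Inner products between
  -- different parts vanish, and disjointness allows L = 1.
  α : Fin n → Fin t → ℤ
  α v i = ι (U i v) * y i v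
  bound-ι : ∀ b → Bounded (ι b) (ι b)
  bound-ι true = -≤+ , ≤-refl
  bound-ι false = ≤-refl , ≤-refl
  term : ∀ a p q y z → a * (p * y * (q * z)) ≡ a * (p * q) * (y * z)
  term = solve-∀
  quads : sum (λ u → sum λ v → ι (adj G u v) * sum λ i → α u i * α v i) ≡
    sum λ i → quad (restrict G (U i)) (y i)
  quads = begin
    sum (λ u → sum λ v → ι (adj G u v) * sum λ i → α u i * α v i)
      ≡⟨ sum₂-cong (λ u v → trans (sym (sum-*ˡ (ι (adj G u v)) (λ i → α u i * α v i)))
           (sum-cong-≗ λ i → trans (term (ι (adj G u v)) (ι (U i u)) (ι (U i v)) (y i u) (y i v))
             (cong (_* (y i u * y i v)) (sym (trans (ι-∧ (adj G u v) (U i u ∧ U i v))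
               (cong (ι (adj G u v) *_) (ι-∧ (U i u) (U i v)))))))) ⟩
    sum (λ u → sum λ v → sum λ i → F i u v)
      ≡⟨ sum-cong-≗ (λ u → ∑-comm λ v i → F i u v) ⟩
    sum (λ u → sum λ i → sum λ v → F i u v)
      ≡⟨ ∑-comm (λ u i → sum λ v → F i u v) ⟩
    sum (λ i → quad (restrict G (U i)) (y i)) ∎
    where
    open ≡-Reasoning
    F : Fin t → Fin n → Fin n → ℤ
    F i u v = ι (adj (restrict G (U i)) u v) * (y i u * y i v)
  gram = gram-rounding G {T} 1ℤ α (λ v i → ι (U i v)) surplus (+<+ (ℕ.s≤s ℕ.z≤n))
    (λ v i → bounded-sgn (lookup (proj₁ (best i)) v) (bound-ι (U i v))) disjoint
  negated : ∀ z → - z ≡ -1ℤ * z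
  negated = solve-∀
  rearrange : ∀ T q → T - -1ℤ * q ≡ 1ℤ * 1ℤ * T + q
  rearrange = solve-∀
  total : sum S ≤ T
  total = by-diff _ (trans (cong (λ z → T - z) (trans (sum-cong-≗ λ i → negated (quad (restrict G (U i)) (y i)))
      (sum-*ˡ -1ℤ (λ i → quad (restrict G (U i)) (y i)))))
    (trans (rearrange T _) (cong (λ z → 1ℤ * 1ℤ * T + z) (sym quads)))) gram

-- Dense graphs

∧-true : ∀ {a b} → a ∧ b ≡ true → a ≡ true × b ≡ true
∧-true {true} {true} _ = refl , refl

ι-split : ∀ z p → ι z ≡ ι (z ∧ not p) + ι (z ∧ p)
ι-split true true = refl
ι-split true false = refl
ι-split false _ = refl

dec-true : ∀ {P : Set} (P? : Dec P) → does P? ≡ true → P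
dec-true (yes p) _ = p

degree : ∀ {n} → Graph n → Fin n → ℤ
degree G v = sum λ u → ι (adj G v u)

edges₂ : ∀ {n} → Graph n → ℤ
edges₂ G = sum (degree G)

0≤degree : ∀ {n} (G : Graph n) v → 0ℤ ≤ degree G v
0≤degree G v = sum-nonneg λ u → 0≤ι (adj G v u)

size : ∀ {n} → (Fin n → Bool) → ℤ
size U = sum λ v → ι (U v)

sum-split : ∀ {n} (Z P : Fin n → Bool) (f : Fin n → ℤ) →
  sum (λ v → ι (Z v) * f v) ≡ sum (λ v → ι (Z v ∧ not (P v)) * f v) + sum (λ v → ι (Z v ∧ P v) * f v)
sum-split Z P f = trans (sum-cong-≗ λ v → trans (cong (_* f v) (ι-split (Z v) (P v)))
  (*-distribʳ-+ (f v) (ι (Z v ∧ not (P v))) (ι (Z v ∧ P v))))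
  (sum-+ (λ v → ι (Z v ∧ not (P v)) * f v) (λ v → ι (Z v ∧ P v) * f v))

record Cover {n} (d : Fin n → ℤ) (P : Fin n → Fin n → Bool) (E : ℤ) (Z : Fin n → Bool) (k : ℕ) : Set where
  field
    class    : Fin k → Fin n → Bool
    centred  : ∀ i → (∀ v → class i v ≡ false) ⊎ (∃ λ w → ∀ v → class i v ≡ true → P v w ≡ true)
    disjoint : ∀ v → sum (λ i → ι (class i v)) ≤ ι (Z v)
    squares  : sum (λ i → size (class i) * size (class i)) ≤ sum λ v → ι (Z v) * d v
    missed   : + 8 * sum (λ v → (ι (Z v) - sum (λ i → ι (class i v))) * size (P v)) ≤ E

-- Each pick lowers the degree sum over Z by at least E / D, which uses up one unit of fuel. At k =
-- 0 a further pick would force E ≤ 0.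
greedy-cover : ∀ {n} (d : Fin n → ℤ) (P : Fin n → Fin n → Bool) D E → (∀ v → 0ℤ ≤ d v) → 0ℤ ≤ D → 0ℤ < E →
  (∀ Z → E < + 8 * sum (λ v → ι (Z v) * size (P v)) → ∃ λ w →
    E ≤ D * sum (λ v → ι (Z v ∧ P v w) * d v) ×
    size (λ v → Z v ∧ P v w) * size (λ v → Z v ∧ P v w) ≤ sum (λ v → ι (Z v ∧ P v w) * d v)) →
  ∀ k Z → D * sum (λ v → ι (Z v) * d v) ≤ + k * E → Cover d P E Z k
greedy-cover {n} d P D E 0≤d 0≤D 0<E pick k Z fuel with E <? + 8 * sum (λ v → ι (Z v) * size (P v))
... | no ¬big = record
  { class = λ _ _ → false
  ; centred = λ _ → inj₁ λ _ → refl
  ; disjoint = λ v → ≤-trans (≤-reflexive (sum-zero {k} λ _ → refl)) (0≤ι (Z v))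
  ; squares = ≤-trans (≤-reflexive (sum-zero {k} λ _ → cong₂ _*_ (sum-zero {n} λ _ → refl) (sum-zero {n} λ _ → refl)))
      (sum-nonneg λ v → 0≤* (0≤ι (Z v)) (0≤d v))
  ; missed = subst (λ z → + 8 * z ≤ E) (sum-cong-≗ λ v → cong (_* size (P v))
      (trans (sym (+-identityʳ (ι (Z v)))) (cong (λ z → ι (Z v) - z) (sym (sum-zero {k} λ _ → refl))))) (≮⇒≥ ¬big)
  }
... | yes big with pick Z big
greedy-cover {n} d P D E 0≤d 0≤D 0<E pick zero Z fuel | yes big | w , gain , _ =
  ⊥-elim (<⇒≱ 0<E (≤-trans gain (≤-trans (*-monoˡ 0≤D (sum-mono λ v → *-monoʳ-≤ v)) (≤-trans fuel (≤-reflexive (*-zeroˡ E))))))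
  where
  *-monoʳ-≤ : ∀ v → ι (Z v ∧ P v w) * d v ≤ ι (Z v) * d v
  *-monoʳ-≤ v = subst₂ _≤_ (*-comm (d v) _) (*-comm (d v) _)
    (*-monoˡ (0≤d v) (ι-mono λ h → proj₁ (∧-true {Z v} h)))
greedy-cover {n} d P D E 0≤d 0≤D 0<E pick (suc k) Z fuel | yes big | w , gain , square = record
  { class = λ { zero → C ; (suc i) → class rest i }
  ; centred = λ { zero → inj₂ (w , λ v h → proj₂ (∧-true {Z v} h)) ; (suc i) → centred rest i }
  ; disjoint = λ v → ≤-trans (+-monoʳ-≤ (ι (C v)) (disjoint rest v))
      (≤-reflexive (trans (+-comm (ι (C v)) (ι (Z′ v))) (sym (ι-split (Z v) (P v w)))))
  ; squares = ≤-trans (+-mono-≤ square (squares rest))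
      (≤-reflexive (trans (+-comm (sum λ v → ι (C v) * d v) (sum λ v → ι (Z′ v) * d v)) (sym (sum-split Z (λ v → P v w) d))))
  ; missed = subst (λ z → + 8 * z ≤ E) (sum-cong-≗ λ v → cong (_* size (P v)) (shift v)) (missed rest)
  }
  where
  open Cover
  C Z′ : Fin n → Bool
  C v = Z v ∧ P v w
  Z′ v = Z v ∧ not (P v w)
  step : ∀ D p c k E → k * E - D * p ≡ ((1ℤ + k) * E - D * (p + c)) + (D * c - E)
  step = solve-∀
  fuel′ : D * sum (λ v → ι (Z′ v) * d v) ≤ + k * E
  fuel′ = by-diff _ (step D (sum λ v → ι (Z′ v) * d v) (sum λ v → ι (C v) * d v) (+ k) E)
    (0≤+ (diff (subst (λ z → D * z ≤ + suc k * E) (sum-split Z (λ v → P v w) d) fuel)) (diff gain))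
  rest : Cover d P E Z′ k
  rest = greedy-cover d P D E 0≤d 0≤D 0<E pick k Z′ fuel′
  shift : ∀ v → ι (Z′ v) - sum (λ i → ι (class rest i v)) ≡ ι (Z v) - (ι (C v) + sum (λ i → ι (class rest i v)))
  shift v = trans (eq (ι (Z′ v)) (ι (C v)) _) (cong (_- (ι (C v) + sum (λ i → ι (class rest i v)))) (sym (ι-split (Z v) (P v w))))
    where
    eq : ∀ z c r → z - r ≡ z + c - (c + r)
    eq = solve-∀

∧-intro : ∀ {a b} → a ≡ true → b ≡ true → a ∧ b ≡ true
∧-intro refl refl = refl

term≤sum : ∀ {n} {f : Fin n → ℤ} → (∀ i → 0ℤ ≤ f i) → ∀ i → f i ≤ sum f
term≤sum {suc n} {f} 0≤f zero = by-diff _ (eq (f zero) _) (sum-nonneg (0≤f ∘ suc))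
  where
  eq : ∀ a b → a + b - a ≡ b
  eq = solve-∀
term≤sum {suc n} {f} 0≤f (suc i) = ≤-trans (term≤sum (0≤f ∘ suc) i) (by-diff _ (eq (f zero) _) (0≤f zero))
  where
  eq : ∀ a b → a + b - b ≡ a
  eq = solve-∀

-- Cliques in neighbourhoods

KFree-restrict : ∀ {r n} (G : Graph n) U → KFree r G → KFree r (restrict G U)
KFree-restrict G U free (f , clique) = free (f , λ i j i≢j → proj₁ (∧-true (clique i j i≢j)))

-- A clique inside U extends by w. That its vertices lie in U is read off from edges of the
-- restricted graph, so each of them needs a second clique vertex; hence the form 2 + ρ.
KFree-neighbourhood : ∀ {ρ n} (G : Graph n) U w → (∀ v → U v ≡ true → adj G v w ≡ true) →
  KFree (3 ℕ.+ ρ) G → KFree (2 ℕ.+ ρ) (restrict G U)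
KFree-neighbourhood {ρ} {n} G U w near free (f , clique) = free (f′ , clique′)
  where
  f′ : Fin (3 ℕ.+ ρ) → Fin n
  f′ zero = w
  f′ (suc i) = f i
  inside : ∀ i → U (f i) ≡ true
  inside zero = proj₁ (∧-true {U (f zero)} (proj₂ (∧-true {adj G (f zero) (f (suc zero))} (clique zero (suc zero) λ ()))))
  inside (suc i) = proj₁ (∧-true {U (f (suc i))} (proj₂ (∧-true {adj G (f (suc i)) (f zero)} (clique (suc i) zero λ ()))))
  clique′ : ∀ i j → i ≢ j → adj G (f′ i) (f′ j) ≡ true
  clique′ zero zero i≢j = ⊥-elim (i≢j refl)
  clique′ zero (suc j) _ = trans (Graph.sym G w (f j)) (near (f j) (inside j))
  clique′ (suc i) zero _ = near (f i) (inside i)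
  clique′ (suc i) (suc j) i≢j = proj₁ (∧-true (clique i j (i≢j ∘ cong suc)))

KFree-empty : ∀ {ρ n} (G : Graph n) U → (∀ v → U v ≡ false) → KFree (2 ℕ.+ ρ) (restrict G U)
KFree-empty G U empty (f , clique)
  with trans (sym (empty (f zero))) (proj₁ (∧-true (proj₂ (∧-true {adj G (f zero) (f (suc zero))} (clique zero (suc zero) λ ())))))
... | ()

K₂-free⇒nonadjacent : ∀ {n} (G : Graph n) → KFree 2 G → ∀ u v → adj G u v ≡ false
K₂-free⇒nonadjacent G free u v with adj G u v in uv
... | false = refl
... | true = ⊥-elim (free (f , clique))
  where
  f : Fin 2 → Fin _
  f zero = u
  f (suc zero) = v
  clique : ∀ i j → i ≢ j → adj G (f i) (f j) ≡ true
  clique zero zero i≢j = ⊥-elim (i≢j refl)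
  clique zero (suc zero) _ = uv
  clique (suc zero) zero _ = trans (Graph.sym G v u) uv
  clique (suc zero) (suc zero) i≢j = ⊥-elim (i≢j refl)

edges₂-restrict-inner : ∀ {n t} (G : Graph n) (U : Fin t → Fin n → Bool) →
  sum (λ i → edges₂ (restrict G (U i))) ≡ sum λ u → sum λ v → ι (adj G u v) * sum λ i → ι (U i u) * ι (U i v)
edges₂-restrict-inner {n} {t} G U = begin
  sum (λ i → sum λ u → sum λ v → a i u v)
    ≡⟨ ∑-comm (λ i u → sum λ v → a i u v) ⟩
  sum (λ u → sum λ i → sum λ v → a i u v)
    ≡⟨ sum-cong-≗ (λ u → ∑-comm λ i v → a i u v) ⟩
  sum (λ u → sum λ v → sum λ i → a i u v)
    ≡⟨ sum₂-cong (λ u v → trans (sum-cong-≗ λ i → trans (ι-∧ (adj G u v) (U i u ∧ U i v))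
         (cong (ι (adj G u v) *_) (ι-∧ (U i u) (U i v)))) (sum-*ˡ (ι (adj G u v)) (λ i → ι (U i u) * ι (U i v)))) ⟩
  _ ∎
  where
  open ≡-Reasoning
  a : Fin t → Fin n → Fin n → ℤ
  a i u v = ι (adj G u v ∧ (U i u ∧ U i v))

-- The vectors 8 t e_i - (e_1 + … + e_t) for v in class i, and - (e_1 + … + e_t) for uncovered v, are negatively
-- correlated along every edge that meets a class and is not contained in one.
class-cut : ∀ {n t} (G : Graph n) {T} (U : Fin t → Fin n → Bool) → Surplus≤ G T → 0ℤ < + t →
  (∀ v → sum (λ i → ι (U i v)) ≤ 1ℤ) →
  + 16 * sum (λ v → sum (λ i → ι (U i v)) * degree G v) ≤
    + 81 * + t * T + + 64 * + t * sum (λ i → edges₂ (restrict G (U i))) + edges₂ G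
class-cut {n} {t} G {T} U surplus 0<t disjoint =
  *-cancelˡ-≤ 0<t (by-diff _ (regroup τ T I S (edges₂ G)) (subst (λ z → 0ℤ ≤ + 9 * τ * (+ 9 * τ) * T + z) total gram))
  where
  open ≡-Reasoning
  τ = + t
  c : Fin n → ℤ
  c v = sum λ i → ι (U i v)
  S = sum λ v → c v * degree G v
  I = sum λ i → edges₂ (restrict G (U i))
  α β : Fin n → Fin t → ℤ
  α v i = + 8 * τ * ι (U i v) - 1ℤ
  β v i = + 8 * τ * ι (U i v) + 1ℤ
  0≤8τι : ∀ i v → 0ℤ ≤ + 8 * τ * ι (U i v)
  0≤8τι i v = 0≤* (0≤* {+ 8} {τ} 0≤+ℕ (<⇒≤ 0<t)) (0≤ι (U i v))
  lower : ∀ z → z - 1ℤ - (- (z + 1ℤ)) ≡ z + z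
  lower = solve-∀
  upper : ∀ z → z + 1ℤ - (z - 1ℤ) ≡ + 2
  upper = solve-∀
  bound : ∀ v i → Bounded (β v i) (α v i)
  bound v i = by-diff _ (lower (+ 8 * τ * ι (U i v))) (0≤+ (0≤8τι i v) (0≤8τι i v)) ,
    by-diff (+ 2) (upper (+ 8 * τ * ι (U i v))) 0≤+ℕ
  slack : ∀ τ c → + 9 * τ - (+ 8 * τ * c + τ * 1ℤ) ≡ + 8 * τ * (1ℤ - c)
  slack = solve-∀
  β-total : ∀ v → sum (β v) ≤ + 9 * τ
  β-total v = by-diff _ (trans (cong (_-_ (+ 9 * τ)) (trans (sum-+ (λ i → + 8 * τ * ι (U i v)) (λ _ → 1ℤ))
      (cong₂ _+_ (sum-*ˡ (+ 8 * τ) (λ i → ι (U i v))) (sum-const t 1ℤ)))) (slack τ (c v)))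
    (0≤* (0≤* {+ 8} {τ} 0≤+ℕ (<⇒≤ 0<t)) (diff (disjoint v)))
  0<9τ : 0ℤ < + 9 * τ
  0<9τ = *-monoˡ-<-pos (+ 9) 0<t
  gram = gram-rounding G {T} (+ 9 * τ) α β surplus 0<9τ bound β-total
  entry : ∀ τ x y → (+ 8 * τ * x - 1ℤ) * (+ 8 * τ * y - 1ℤ) ≡ + 64 * τ * τ * (x * y) + (- (+ 8 * τ)) * (x + y) + 1ℤ
  entry = solve-∀
  inner : ∀ u v → sum (λ i → α u i * α v i) ≡
    + 64 * τ * τ * sum (λ i → ι (U i u) * ι (U i v)) + (- (+ 8 * τ)) * (c u + c v) + τ * 1ℤ
  inner u v = begin
    sum (λ i → α u i * α v i)
      ≡⟨ sum-cong-≗ (λ i → entry τ (ι (U i u)) (ι (U i v))) ⟩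
    sum (λ i → + 64 * τ * τ * (ι (U i u) * ι (U i v)) + (- (+ 8 * τ)) * (ι (U i u) + ι (U i v)) + 1ℤ)
      ≡⟨ trans (sum-+ (λ i → + 64 * τ * τ * (ι (U i u) * ι (U i v)) + (- (+ 8 * τ)) * (ι (U i u) + ι (U i v))) (λ _ → 1ℤ))
           (cong₂ _+_ (sum-+ (λ i → + 64 * τ * τ * (ι (U i u) * ι (U i v))) (λ i → (- (+ 8 * τ)) * (ι (U i u) + ι (U i v))))
             (sum-const t 1ℤ)) ⟩
    sum (λ i → + 64 * τ * τ * (ι (U i u) * ι (U i v))) + sum (λ i → (- (+ 8 * τ)) * (ι (U i u) + ι (U i v))) + τ * 1ℤ
      ≡⟨ cong (_+ τ * 1ℤ) (cong₂ _+_ (sum-*ˡ (+ 64 * τ * τ) (λ i → ι (U i u) * ι (U i v)))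
           (trans (sum-*ˡ (- (+ 8 * τ)) (λ i → ι (U i u) + ι (U i v)))
             (cong (_*_ (- (+ 8 * τ))) (sum-+ (λ i → ι (U i u)) (λ i → ι (U i v)))))) ⟩
    _ ∎
  weigh : ∀ a τ x c d → a * (+ 64 * τ * τ * x + (- (+ 8 * τ)) * (c + d) + τ * 1ℤ) ≡
    + 64 * τ * τ * (a * x) + (- (+ 8 * τ)) * (c * a + d * a) + τ * a
  weigh = solve-∀
  total : sum (λ u → sum λ v → ι (adj G u v) * sum λ i → α u i * α v i) ≡
    + 64 * τ * τ * I + (- (+ 8 * τ)) * (S + S) + τ * edges₂ G
  total = begin
    sum (λ u → sum λ v → ι (adj G u v) * sum λ i → α u i * α v i)
      ≡⟨ sum₂-cong (λ u v → trans (cong (ι (adj G u v) *_) (inner u v)) (weigh (ι (adj G u v)) τ _ (c u) (c v))) ⟩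
    sum (λ u → sum λ v → + 64 * τ * τ * X u v + (- (+ 8 * τ)) * (Y u v + Y′ u v) + τ * ι (adj G u v))
      ≡⟨ trans (sum₂-+ (λ u v → + 64 * τ * τ * X u v + (- (+ 8 * τ)) * (Y u v + Y′ u v)) (λ u v → τ * ι (adj G u v)))
           (cong₂ _+_ (trans (sum₂-+ (λ u v → + 64 * τ * τ * X u v) (λ u v → (- (+ 8 * τ)) * (Y u v + Y′ u v)))
             (cong₂ _+_ (sum₂-*ˡ (+ 64 * τ * τ) X) (trans (sum₂-*ˡ (- (+ 8 * τ)) (λ u v → Y u v + Y′ u v))
               (cong (_*_ (- (+ 8 * τ))) (sum₂-+ Y Y′))))) (sum₂-*ˡ τ (λ u v → ι (adj G u v)))) ⟩
    + 64 * τ * τ * sum (λ u → sum (X u)) + (- (+ 8 * τ)) * (sum (λ u → sum (Y u)) + sum (λ u → sum (Y′ u))) + τ * edges₂ G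
      ≡⟨ cong (_+ τ * edges₂ G) (cong₂ _+_ (cong (_*_ (+ 64 * τ * τ)) (sym (edges₂-restrict-inner G U)))
           (cong (_*_ (- (+ 8 * τ))) (cong₂ _+_ (sum-cong-≗ λ u → sum-*ˡ (c u) (λ v → ι (adj G u v)))
             (trans (∑-comm Y′) (sum-cong-≗ λ v → trans (sum-cong-≗ λ u → cong (λ b → c v * ι b) (Graph.sym G u v))
               (sum-*ˡ (c v) (λ u → ι (adj G v u)))))))) ⟩
    _ ∎
    where
    X Y Y′ : Fin n → Fin n → ℤ
    X u v = ι (adj G u v) * sum λ i → ι (U i u) * ι (U i v)
    Y u v = c u * ι (adj G u v)
    Y′ u v = c v * ι (adj G u v)
  regroup : ∀ τ T I S E → τ * (+ 81 * τ * T + + 64 * τ * I + E) - τ * (+ 16 * S) ≡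
    + 9 * τ * (+ 9 * τ) * T + (+ 64 * τ * τ * I + (- (+ 8 * τ)) * (S + S) + τ * E)
  regroup = solve-∀

*-monoʳ : ∀ {c x y} → 0ℤ ≤ c → x ≤ y → x * c ≤ y * c
*-monoʳ {c} {x} {y} 0≤c x≤y = subst₂ _≤_ (*-comm c x) (*-comm c y) (*-monoˡ 0≤c x≤y)

0<⇒0<+ : ∀ {q} → 1 ℕ.≤ q → 0ℤ < + q
0<⇒0<+ 1≤q = +<+ 1≤q

^-distribʳ-* : ∀ k m n → (m ℕ.* n) ℕ.^ k ≡ m ℕ.^ k ℕ.* n ℕ.^ k
^-distribʳ-* zero m n = refl
^-distribʳ-* (suc k) m n = trans (cong (m ℕ.* n ℕ.*_) (^-distribʳ-* k m n)) (exchange m n (m ℕ.^ k) (n ℕ.^ k))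
  where
  exchange : ∀ a b c d → a ℕ.* b ℕ.* (c ℕ.* d) ≡ a ℕ.* c ℕ.* (b ℕ.* d)
  exchange = ℕSolver.solve-∀

-- Opaque, since unfolding these numerals during conversion checking is prohibitively slow.
opaque
  refinement : ℕ
  refinement = 4096

  refinement≡ : + refinement ≡ + 4096
  refinement≡ = refl

  base-cost : ℕ
  base-cost = 5184

  base-cost≡ : + base-cost ≡ + 5184
  base-cost≡ = refl

  classes : ℕ → ℕ
  classes q = 32 ℕ.* q

  classes≡ : ∀ q → + classes q ≡ + 32 * + q
  classes≡ q = pos-* 32 q

dense-constant : ℕ → ℕ
dense-constant zero = 0
dense-constant (suc ρ) = base-cost ℕ.+ dense-constant ρ ℕ.* refinement ℕ.^ suc ρ

-- This is where the constants come from. By the first hypothesis 16 S ≥ 2 E, so the cut inequality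
-- leaves E ≤ 81 · 32 κ T + 64 · 32 κ I. The density parameter of the classes is 4096 κ = 2 · 64 ·
-- 32 κ, so the last term is at most (E + c T) / 2. Absorbing E / 2 doubles the rest, and 5184 = 2 ·
-- 81 · 32.
dense-arithmetic : ∀ κ T E I S c → E ≤ + 8 * S →
  + 16 * S ≤ + 81 * (+ 32 * κ) * T + + 64 * (+ 32 * κ) * I + E → + 4096 * κ * I ≤ E + c * T →
  E ≤ (+ 5184 * κ + c) * T
dense-arithmetic κ T E I S c E≤8S cut inner = by-diff _ (combine κ T E I S c)
  (0≤+ (0≤* {+ 4} 0≤+ℕ (diff E≤8S)) (0≤+ (0≤* {+ 2} 0≤+ℕ (diff cut)) (diff inner)))
  where
  combine : ∀ κ T E I S c → (+ 5184 * κ + c) * T - E ≡ + 4 * (+ 8 * S - E) +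
    (+ 2 * (+ 81 * (+ 32 * κ) * T + + 64 * (+ 32 * κ) * I + E - + 16 * S) + (E + c * T - + 4096 * κ * I))
  combine = solve-∀

-- Disjoint neighbourhoods in a dense graph

module DenseStep {n} (G : Graph n) (U : Fin n → Bool) (supported : ∀ u v → adj G u v ≡ true → U u ≡ true)
  (q : ℕ) (1≤q : 1 ℕ.≤ q) (dense : size U * size U < + q * edges₂ G) where

  d : Fin n → ℤ
  d = degree G

  ν E κ : ℤ
  ν = size U
  E = edges₂ G
  κ = + q

  0≤ν : 0ℤ ≤ ν
  0≤ν = sum-nonneg λ v → 0≤ι (U v)

  0≤κ : 0ℤ ≤ κ
  0≤κ = 0≤+ℕ

  0<κ : 0ℤ < κ
  0<κ = 0<⇒0<+ 1≤q

  0<E : 0ℤ < E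
  0<E = ≰⇒> λ E≤0 → <⇒≱ dense (≤-trans (*-monoˡ 0≤κ E≤0) (≤-trans (≤-reflexive (*-zeroʳ κ)) (0≤* 0≤ν 0≤ν)))

  big : Fin n → Bool
  big w = does (ν ≤? + 4 * κ * d w)

  below : Fin n → Fin n → Bool
  below w v = does (d w ≤? d v)

  P : Fin n → Fin n → Bool
  P v w = adj G v w ∧ (below w v ∧ big w)

  P-adj : ∀ v w → P v w ≡ true → adj G v w ≡ true
  P-adj v w h = proj₁ (∧-true h)

  P-below : ∀ v w → P v w ≡ true → d w ≤ d v
  P-below v w h = dec-true (d w ≤? d v) (proj₁ (∧-true (proj₂ (∧-true {adj G v w} h))))

  P-big : ∀ v w → P v w ≡ true → ν ≤ + 4 * κ * d w
  P-big v w h = dec-true (ν ≤? + 4 * κ * d w) (proj₂ (∧-true {below w v} (proj₂ (∧-true {adj G v w} h))))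

  P-supp : ∀ v w → P v w ≡ true → U w ≡ true
  P-supp v w h = supported w v (trans (Graph.sym G w v) (P-adj v w h))

  ∣P∣ : ℤ
  ∣P∣ = sum λ v → size (P v)

  Down Light : ℤ
  Down = sum λ v → sum λ w → ι (adj G v w ∧ below w v)
  Light = sum λ v → sum λ w → ι (adj G v w ∧ not (big w))

  E≤2Down : E ≤ Down + Down
  E≤2Down = ≤-trans (sum₂-mono λ v w → orient v w) (≤-reflexive (trans
    (sum₂-+ (λ v w → ι (adj G v w ∧ below w v)) (λ v w → ι (adj G w v ∧ below v w)))
    (cong (_+_ Down) (∑-comm λ v w → ι (adj G w v ∧ below v w)))))
    where
    comparable : ∀ v w → 1ℤ ≤ ι (below w v) + ι (below v w)
    comparable v w with d w ≤? d v | d v ≤? d w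
    ... | yes _ | yes _ = +≤+ (ℕ.s≤s ℕ.z≤n)
    ... | yes _ | no _ = ≤-refl
    ... | no _ | yes _ = ≤-refl
    ... | no ¬p | no ¬q = ⊥-elim (¬q (<⇒≤ (≰⇒> ¬p)))
    orient : ∀ v w → ι (adj G v w) ≤ ι (adj G v w ∧ below w v) + ι (adj G w v ∧ below v w)
    orient v w rewrite Graph.sym G w v with adj G v w
    ... | true = comparable v w
    ... | false = ≤-refl

  Down≤ : Down ≤ ∣P∣ + Light
  Down≤ = ≤-trans (sum₂-mono λ v w → step (adj G v w) (below w v) (big w))
    (≤-reflexive (sum₂-+ (λ v w → ι (P v w)) (λ v w → ι (adj G v w ∧ not (big w)))))
    where
    step : ∀ a b c → ι (a ∧ b) ≤ ι (a ∧ (b ∧ c)) + ι (a ∧ not c)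
    step false _ _ = ≤-refl
    step true false true = ≤-refl
    step true false false = +≤+ ℕ.z≤n
    step true true true = ≤-refl
    step true true false = ≤-refl

  -- A vertex of U that is not big has 4 κ d w < ν, there are at most ν of them, and vertices
  -- outside U have no edges.
  Light≤ : + 4 * κ * Light ≤ ν * ν
  Light≤ = subst₂ _≤_ (trans (sum-*ˡ (+ 4 * κ) (λ w → sum λ v → ι (adj G v w ∧ not (big w))))
      (cong (_*_ (+ 4 * κ)) (∑-comm λ w v → ι (adj G v w ∧ not (big w))))) (sum-*ˡ ν (λ w → ι (U w)))
    (sum-mono column)
    where
    column : ∀ w → + 4 * κ * sum (λ v → ι (adj G v w ∧ not (big w))) ≤ ν * ι (U w)
    column w with ν ≤? + 4 * κ * d w
    ... | yes _ = ≤-trans (≤-reflexive (trans (cong (_*_ (+ 4 * κ)) (sum-zero λ v → none (adj G v w))) (*-zeroʳ (+ 4 * κ))))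
            (0≤* 0≤ν (0≤ι (U w)))
      where
      none : ∀ a → ι (a ∧ false) ≡ 0ℤ
      none true = refl
      none false = refl
    ... | no small with U w in Uw
    ...   | true = ≤-trans (≤-reflexive (cong (_*_ (+ 4 * κ)) (sum-cong-≗ λ v → all (adj G v w) (adj G w v) (Graph.sym G v w))))
              (≤-trans (<⇒≤ (≰⇒> small)) (≤-reflexive (sym (*-identityʳ ν))))
      where
      all : ∀ a b → a ≡ b → ι (a ∧ true) ≡ ι b
      all true .true refl = refl
      all false .false refl = refl
    ...   | false = ≤-trans (≤-reflexive (trans (cong (_*_ (+ 4 * κ)) (sum-zero λ v → outside v)) (*-zeroʳ (+ 4 * κ))))
              (≤-reflexive (sym (*-zeroʳ ν)))
      where
      outside : ∀ v → ι (adj G v w ∧ true) ≡ 0ℤ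
      outside v with adj G v w in vw
      ... | false = refl
      ... | true with trans (sym Uw) (supported w v (trans (Graph.sym G w v) vw))
      ... | ()

  -- One of the two directions of every edge points down, so E ≤ 2 ∣P∣ + 2 Light, and the density
  -- hypothesis makes Light at most E / 4.
  E≤4∣P∣ : E ≤ + 4 * ∣P∣
  E≤4∣P∣ = by-diff _ (eq E Down ∣P∣ Light)
    (0≤+ (0≤+ (0≤+ (diff E≤2Down) (diff E≤2Down)) (0≤* {+ 4} 0≤+ℕ (diff Down≤))) (diff 4Light≤E))
    where
    assoc : ∀ k l → + 4 * k * l ≡ k * (+ 4 * l)
    assoc = solve-∀
    4Light≤E : + 4 * Light ≤ E
    4Light≤E = *-cancelˡ-≤ 0<κ (≤-trans (≤-reflexive (sym (assoc κ Light))) (≤-trans Light≤ (<⇒≤ dense)))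
    eq : ∀ E D P L → + 4 * P - E ≡ ((D + D - E) + (D + D - E) + + 4 * (P + L - D)) + (E - + 4 * L)
    eq = solve-∀

  0<ν : 0ℤ < ν
  0<ν with sum-positive {n} {d} 0<E
  ... | v , 0<dv with sum-positive {n} {λ u → ι (adj G v u)} 0<dv
  ... | u , 0<a with adj G v u in vu
  ...   | true = <-≤-trans (+<+ (ℕ.s≤s ℕ.z≤n)) (≤-trans (≤-reflexive (cong ι (sym (supported v u vu))))
            (term≤sum {f = λ v → ι (U v)} (λ v → 0≤ι (U v)) v))
  0<ν | v , 0<dv | u , +<+ () | false

  module _ (Z : Fin n → Bool) where

    C : Fin n → Fin n → Bool
    C w v = Z v ∧ P v w

    Ψ : ℤ
    Ψ = sum λ v → ι (Z v) * size (P v)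

    -- Positive total means that, on average over the ν vertices w of U, the size of `C w` exceeds E
    -- / (8 ν).
    h : Fin n → ℤ
    h w = + 8 * ν * size (C w) + (- E) * ι (U w)

    h-total : sum h ≡ ν * (+ 8 * Ψ - E)
    h-total = trans (sum-+ (λ w → + 8 * ν * size (C w)) (λ w → (- E) * ι (U w))) (trans (cong₂ _+_
      (trans (sum-*ˡ (+ 8 * ν) (λ w → size (C w))) (cong (_*_ (+ 8 * ν)) Ψ≡)) (sum-*ˡ (- E) (λ w → ι (U w)))) (eq ν Ψ E))
      where
      eq : ∀ ν Ψ E → + 8 * ν * Ψ + (- E) * ν ≡ ν * (+ 8 * Ψ - E)
      eq = solve-∀
      Ψ≡ : sum (λ w → size (C w)) ≡ Ψ
      Ψ≡ = trans (∑-comm λ w v → ι (C w v)) (sum-cong-≗ λ v →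
        trans (sum-cong-≗ λ w → ι-∧ (Z v) (P v w)) (sum-*ˡ (ι (Z v)) (λ w → ι (P v w))))

    h-positive : E < + 8 * Ψ → 0ℤ < sum h
    h-positive E<8Ψ = subst (0ℤ <_) (sym h-total) (≰⇒> λ ν*≤0 → <⇒≱ E<8Ψ (by-diff _ (eq E (+ 8 * Ψ))
      (*-cancelˡ-nonneg 0<ν (by-diff _ (eq′ ν (+ 8 * Ψ - E)) (diff ν*≤0)))))
      where
      eq : ∀ E x → E - x ≡ - (x - E)
      eq = solve-∀
      eq′ : ∀ ν x → ν * (- x) - 0ℤ ≡ 0ℤ - ν * x
      eq′ = solve-∀

    0≤size : ∀ w → 0ℤ ≤ size (C w)
    0≤size w = sum-nonneg λ v → 0≤ι (C w v)

    occupied : ∀ w → 0ℤ < h w → ∃ λ v → P v w ≡ true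
    occupied w 0<hw = inhabited (sum-positive {n} {λ v → ι (C w v)} 0<size)
      where
      eq : ∀ ν u E i → 0ℤ - (+ 8 * ν * u + (- E) * i) ≡ + 8 * ν * (0ℤ - u) + E * i
      eq = solve-∀
      0<size : 0ℤ < size (C w)
      0<size = ≰⇒> λ size≤0 → <⇒≱ 0<hw (by-diff _ (eq ν (size (C w)) E (ι (U w)))
        (0≤+ (0≤* (0≤* {+ 8} 0≤+ℕ 0≤ν) (diff size≤0)) (0≤* (<⇒≤ 0<E) (0≤ι (U w)))))
      positive⇒true : ∀ b → 0ℤ < ι b → b ≡ true
      positive⇒true true _ = refl
      positive⇒true false (+<+ ())
      inhabited : (∃ λ v → 0ℤ < ι (C w v)) → ∃ λ v → P v w ≡ true
      inhabited (v , 0<ι) = v , proj₂ (∧-true {Z v} (positive⇒true (C w v) 0<ι))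

    size≤degree : ∀ w → size (C w) ≤ d w
    size≤degree w = sum-mono λ v → ι-mono λ h → trans (Graph.sym G w v) (P-adj v w (proj₂ (∧-true {Z v} h)))

    size*degree≤ : ∀ w → size (C w) * d w ≤ sum (λ v → ι (C w v) * d v)
    size*degree≤ w = ≤-trans (≤-reflexive (sym (sum-*ʳ (d w) (λ v → ι (C w v)))))
      (sum-mono λ v → step v (C w v) λ h → P-below v w (proj₂ (∧-true {Z v} h)))
      where
      step : ∀ v b → (b ≡ true → d w ≤ d v) → ι b * d w ≤ ι b * d v
      step v true le = *-monoˡ {1ℤ} 0≤+ℕ (le refl)
      step v false _ = ≤-refl

    -- The chain is E < 8 ν |C| ≤ 32 κ |C| d w, at most 32 κ times the degree sum over C, where C is
    -- `C w`. It uses that w is big and of smallest degree. This is why 32 κ classes are enough.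
    gain : ∀ w → 0ℤ < h w → E ≤ + 32 * κ * sum (λ v → ι (C w v) * d v)
    gain w 0<hw = by-diff _ (eq E ν κ (size (C w)) (d w) (sum λ v → ι (C w v) * d v))
      (0≤+ (0≤+ (<⇒≤ (subst (λ b → 0ℤ < + 8 * ν * size (C w) + (- E) * ι b) (P-supp v w Pvw) 0<hw))
        (0≤* (0≤* {+ 8} 0≤+ℕ (0≤size w)) (diff (P-big v w Pvw))))
        (0≤* (0≤* {+ 32} 0≤+ℕ 0≤κ) (diff (size*degree≤ w))))
      where
      v = proj₁ (occupied w 0<hw)
      Pvw = proj₂ (occupied w 0<hw)
      eq : ∀ E ν κ u d g → + 32 * κ * g - E ≡
        (+ 8 * ν * u + (- E) * 1ℤ) + + 8 * u * (+ 4 * κ * d - ν) + + 32 * κ * (g - u * d)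
      eq = solve-∀

    pick : E < + 8 * Ψ → ∃ λ w → E ≤ + 32 * κ * sum (λ v → ι (C w v) * d v) ×
      size (C w) * size (C w) ≤ sum (λ v → ι (C w v) * d v)
    pick E<8Ψ = choose (sum-positive {n} {h} (h-positive E<8Ψ))
      where
      choose : (∃ λ w → 0ℤ < h w) → ∃ λ w → E ≤ + 32 * κ * sum (λ v → ι (C w v) * d v) ×
        size (C w) * size (C w) ≤ sum (λ v → ι (C w v) * d v)
      choose (w , 0<hw) = w , gain w 0<hw , ≤-trans (*-monoˡ (0≤size w) (size≤degree w)) (size*degree≤ w)

  everything : sum (λ v → 1ℤ * d v) ≡ E
  everything = sum-cong-≗ λ v → *-identityˡ (d v)

  cover : ∀ t → + t ≡ + 32 * κ → Cover d P E (λ _ → true) t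
  cover t τ≡ = greedy-cover d P (+ 32 * κ) E (0≤degree G) (0≤* {+ 32} 0≤+ℕ 0≤κ) 0<E pick t (λ _ → true)
    (≤-reflexive (cong₂ _*_ (sym τ≡) everything))

  module Covered {t} (family : Cover d P E (λ _ → true) t) where

    open Cover family public

    cov : Fin n → ℤ
    cov v = sum λ i → ι (class i v)

    -- From 2 E ≤ 8 ∣P∣, the uncovered vertices account for at most E. At covered vertices
    -- `size (P v)` is at most the degree.
    E≤8covered : E ≤ + 8 * sum (λ v → cov v * d v)
    E≤8covered = by-diff _ (eq E ∣P∣ (sum λ v → cov v * d v) (sum λ v → cov v * size (P v)))
      (0≤+ (0≤+ (0≤+ (diff E≤4∣P∣) (diff E≤4∣P∣)) (diff missed′))
        (0≤* {+ 8} 0≤+ℕ (diff (sum-mono λ v → *-monoˡ (sum-nonneg λ i → 0≤ι (class i v)) (sum-mono λ w → ι-mono (P-adj v w))))))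
      where
      missed′ : + 8 * (∣P∣ + -1ℤ * sum (λ v → cov v * size (P v))) ≤ E
      missed′ = subst (λ z → + 8 * z ≤ E) (trans (sum-cong-≗ λ v → expand (cov v) (size (P v)))
        (trans (sum-+ (λ v → size (P v)) (λ v → -1ℤ * (cov v * size (P v))))
          (cong (_+_ ∣P∣) (sum-*ˡ -1ℤ (λ v → cov v * size (P v)))))) missed
        where
        expand : ∀ c p → (1ℤ - c) * p ≡ p + -1ℤ * (c * p)
        expand = solve-∀
      eq : ∀ E P S S′ → + 8 * S - E ≡ (+ 4 * P - E) + (+ 4 * P - E) + (E - + 8 * (P + -1ℤ * S′)) + + 8 * (S - S′)
      eq = solve-∀

    squares≤E : sum (λ i → size (class i) * size (class i)) ≤ E
    squares≤E = ≤-trans squares (≤-reflexive everything)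

    class-KFree : ∀ {ρ} → KFree (3 ℕ.+ ρ) G → ∀ i → KFree (2 ℕ.+ ρ) (restrict G (class i))
    class-KFree free i with centred i
    ... | inj₁ empty = KFree-empty G (class i) empty
    ... | inj₂ (w , near) = KFree-neighbourhood G (class i) w (λ v h → P-adj v w (near v h)) free

-- The edge density of a K_r-free graph is at most 1/q unless the surplus is at least e(G) / q^(r-2), up to constants.
-- Disjoint neighbourhoods inherit the dichotomy for r - 1; if all of them are sparse, they are the classes of a large cut.
dense-bound : ∀ ρ {n} (G : Graph n) U → (∀ u v → adj G u v ≡ true → U u ≡ true) → ∀ q {T} → 1 ℕ.≤ q →
  KFree (2 ℕ.+ ρ) G → Surplus≤ G T →
  + q * edges₂ G ≤ size U * size U + + (dense-constant ρ ℕ.* q ℕ.^ suc ρ) * T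
dense-bound zero {n} G U _ q {T} _ free surplus = ≤-trans
  (≤-reflexive (trans (cong (+ q *_) (sum-zero λ u → sum-zero λ v → cong ι (K₂-free⇒nonadjacent G free u v))) (*-zeroʳ (+ q))))
  (0≤+ (0≤* 0≤size 0≤size) (0≤* {+ 0} 0≤+ℕ (surplus-nonneg G {T} surplus)))
  where
  0≤size : 0ℤ ≤ size U
  0≤size = sum-nonneg λ v → 0≤ι (U v)
dense-bound (suc ρ) {n} G U supported q {T} 1≤q free surplus with size U * size U <? + q * edges₂ G
... | no sparse = ≤-trans (≮⇒≥ sparse) (by-diff (+ N * T) (eq (size U * size U) (+ N * T))
    (0≤* {+ N} 0≤+ℕ (surplus-nonneg G {T} surplus)))
  where
  N : ℕ
  N = dense-constant (suc ρ) ℕ.* q ℕ.^ suc (suc ρ)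
  eq : ∀ x y → x + y - x ≡ y
  eq = solve-∀
... | yes dense = ≤-trans (≤-trans (*-monoˡ 0≤κ E≤) (≤-reflexive (sym (*-assoc κ (+ base-cost * κ + + c′) T))))
    (≤-trans (*-monoʳ 0≤T (≤-trans (≤-reflexive (sym cast)) (+≤+ constants)))
      (by-diff (size U * size U) (eq (size U * size U) (+ N * T)) (0≤* 0≤ν 0≤ν)))
  where
  open DenseStep G U supported q 1≤q dense
  open Covered (cover (classes q) (classes≡ q))
  open ℕ.≤-Reasoning
  N q′ c′ : ℕ
  N = dense-constant (suc ρ) ℕ.* q ℕ.^ suc (suc ρ)
  q′ = refinement ℕ.* q
  c′ = dense-constant ρ ℕ.* q′ ℕ.^ suc ρ
  eq : ∀ x y → x + y - y ≡ x
  eq = solve-∀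
  0≤T : 0ℤ ≤ T
  0≤T = surplus-nonneg G {T} surplus
  1≤q′ : 1 ℕ.≤ q′
  1≤q′ = ℕ.*-mono-≤ {1} {refinement} {1} (drop‿+≤+ (subst (1ℤ ≤_) (sym refinement≡) (+≤+ (ℕ.s≤s ℕ.z≤n)))) 1≤q
  parts = disjoint-surplus G {T} class surplus disjoint
  S : Fin (classes q) → ℤ
  S = proj₁ parts
  I : ℤ
  I = sum λ i → edges₂ (restrict G (class i))
  hypothesis : ∀ i → + q′ * edges₂ (restrict G (class i)) ≤ size (class i) * size (class i) + + c′ * S i
  hypothesis i = dense-bound ρ (restrict G (class i)) (class i)
    (λ u v h → proj₁ (∧-true (proj₂ (∧-true {adj G u v} h)))) q′ {S i} 1≤q′
    (class-KFree free i) (proj₁ (proj₂ (proj₂ parts)) i)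
  -- Summed over the classes, the quadratic terms of the induction hypothesis cost only E, by
  -- `squares≤E`, although the classes may be dense individually.
  I≤ : + 4096 * κ * I ≤ E + + c′ * T
  I≤ = ≤-trans (≤-reflexive (trans (cong (_* I) (sym (trans (pos-* refinement q) (cong (_* κ) refinement≡))))
      (sym (sum-*ˡ (+ q′) (λ i → edges₂ (restrict G (class i)))))))
    (≤-trans (sum-mono hypothesis) (≤-trans (≤-reflexive (trans (sum-+ (λ i → size (class i) * size (class i)) (λ i → + c′ * S i))
      (cong (_+_ (sum λ i → size (class i) * size (class i))) (sum-*ˡ (+ c′) S))))
      (+-mono-≤ squares≤E (*-monoˡ {+ c′} 0≤+ℕ (proj₂ (proj₂ (proj₂ parts)))))))
  cut≤ : + 16 * sum (λ v → cov v * d v) ≤ + 81 * (+ 32 * κ) * T + + 64 * (+ 32 * κ) * I + E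
  cut≤ = subst (λ τ → + 16 * sum (λ v → cov v * d v) ≤ + 81 * τ * T + + 64 * τ * I + E) (classes≡ q)
    (class-cut G {T} class surplus (subst (0ℤ <_) (sym (classes≡ q)) (*-monoˡ-<-pos (+ 32) 0<κ)) disjoint)
  E≤ : E ≤ (+ base-cost * κ + + c′) * T
  E≤ = subst (λ b → E ≤ (b * κ + + c′) * T) (sym base-cost≡)
    (dense-arithmetic κ T E I (sum λ v → cov v * d v) (+ c′) E≤8covered cut≤ I≤)
  cast : + (q ℕ.* (base-cost ℕ.* q ℕ.+ c′)) ≡ κ * (+ base-cost * κ + + c′)
  cast = trans (pos-* q (base-cost ℕ.* q ℕ.+ c′)) (cong (λ z → κ * (z + + c′)) (pos-* base-cost q))
  constants : q ℕ.* (base-cost ℕ.* q ℕ.+ c′) ℕ.≤ N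
  constants = begin
    q ℕ.* (base-cost ℕ.* q ℕ.+ c ℕ.* q′ ℕ.^ suc ρ)
      ≡⟨ cong (λ z → q ℕ.* (base-cost ℕ.* q ℕ.+ c ℕ.* z)) (^-distribʳ-* (suc ρ) refinement q) ⟩
    q ℕ.* (base-cost ℕ.* q ℕ.+ c ℕ.* (refinement ℕ.^ suc ρ ℕ.* q ℕ.^ suc ρ))
      ≤⟨ ℕ.*-monoʳ-≤ q (ℕ.+-monoˡ-≤ (c ℕ.* (refinement ℕ.^ suc ρ ℕ.* q ℕ.^ suc ρ)) (ℕ.*-monoʳ-≤ base-cost q≤)) ⟩
    q ℕ.* (base-cost ℕ.* q ℕ.^ suc ρ ℕ.+ c ℕ.* (refinement ℕ.^ suc ρ ℕ.* q ℕ.^ suc ρ))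
      ≡⟨ assemble base-cost q c (refinement ℕ.^ suc ρ) (q ℕ.^ suc ρ) ⟩
    (base-cost ℕ.+ c ℕ.* refinement ℕ.^ suc ρ) ℕ.* (q ℕ.* q ℕ.^ suc ρ) ∎
    where
    c = dense-constant ρ
    q≤ : q ℕ.≤ q ℕ.^ suc ρ
    q≤ = ℕ.m≤m*n q (q ℕ.^ ρ) ⦃ ℕ.m^n≢0 q ρ ⦃ ℕ.>-nonZero 1≤q ⦄ ⦄
    assemble : ∀ k q C a b → q ℕ.* (k ℕ.* b ℕ.+ C ℕ.* (a ℕ.* b)) ≡ (k ℕ.+ C ℕ.* a) ℕ.* (q ℕ.* b)
    assemble = ℕSolver.solve-∀

-- A bounded odd function of random signs

prod : ∀ {n} → (Fin n → ℤ) → ℤ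
prod {zero} f = 1ℤ
prod {suc n} f = f zero * prod (f ∘ suc)

prod-nonneg : ∀ {n} {f : Fin n → ℤ} → (∀ i → 0ℤ ≤ f i) → 0ℤ ≤ prod f
prod-nonneg {zero} _ = +≤+ ℕ.z≤n
prod-nonneg {suc n} 0≤f = 0≤* (0≤f zero) (prod-nonneg (0≤f ∘ suc))

prod-mono : ∀ {n} {f g : Fin n → ℤ} → (∀ i → 0ℤ ≤ f i) → (∀ i → f i ≤ g i) → prod f ≤ prod g
prod-mono {zero} _ _ = ≤-refl
prod-mono {suc n} {f} {g} 0≤f f≤g = by-diff _ (eq (f zero) (g zero) (prod (f ∘ suc)) (prod (g ∘ suc)))
  (0≤+ (0≤* (≤-trans (0≤f zero) (f≤g zero)) (diff (prod-mono (0≤f ∘ suc) (f≤g ∘ suc))))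
    (0≤* (diff (f≤g zero)) (prod-nonneg (0≤f ∘ suc))))
  where
  eq : ∀ a b p q → b * q - a * p ≡ b * (q - p) + (b - a) * p
  eq = solve-∀

pow : ∀ n → ℤ → ℤ
pow n A = prod {n} λ _ → A

-- Telescoping: exchanging one factor at a time changes the product by at most A^(n-1) times the
-- change of the factor. The extra factor A avoids the exponent n - 1.
prod-gap : ∀ {n} A (α β : Fin n → ℤ) → (∀ i → 0ℤ ≤ β i) → (∀ i → β i ≤ α i) → (∀ i → α i ≤ A) →
  A * (prod α - prod β) ≤ pow n A * sum (λ i → α i - β i)
prod-gap {zero} A α β _ _ _ = ≤-reflexive (eq A)
  where
  eq : ∀ A → A * (1ℤ - 1ℤ) ≡ 1ℤ * 0ℤ
  eq = solve-∀
prod-gap {suc n} A α β 0≤β β≤α α≤A = by-diff _ (eq A (α zero) (β zero) a b P Σ′)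
  (0≤+ (0≤+ (0≤* 0≤α (diff ih)) (0≤* (diff (α≤A zero)) (0≤* 0≤P 0≤Σ)))
    (0≤* (0≤* 0≤A (diff (β≤α zero))) (diff b≤P)))
  where
  a = prod (α ∘ suc)
  b = prod (β ∘ suc)
  P = pow n A
  Σ′ = sum λ i → α (suc i) - β (suc i)
  ih = prod-gap A (α ∘ suc) (β ∘ suc) (0≤β ∘ suc) (β≤α ∘ suc) (α≤A ∘ suc)
  0≤α : 0ℤ ≤ α zero
  0≤α = ≤-trans (0≤β zero) (β≤α zero)
  0≤A : 0ℤ ≤ A
  0≤A = ≤-trans 0≤α (α≤A zero)
  0≤P : 0ℤ ≤ P
  0≤P = prod-nonneg {n} λ _ → 0≤A
  0≤Σ : 0ℤ ≤ Σ′
  0≤Σ = sum-nonneg λ i → diff (β≤α (suc i))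
  b≤P : b ≤ P
  b≤P = prod-mono (0≤β ∘ suc) λ i → ≤-trans (β≤α (suc i)) (α≤A (suc i))
  eq : ∀ A x y a b P S → A * P * ((x - y) + S) - A * (x * a - y * b) ≡
    x * (P * S - A * (a - b)) + (A - x) * (P * S) + A * (x - y) * (P - b)
  eq = solve-∀

prod-* : ∀ {n} (f g : Fin n → ℤ) → prod (λ i → f i * g i) ≡ prod f * prod g
prod-* {zero} f g = refl
prod-* {suc n} f g = trans (cong (f zero * g zero *_) (prod-* (f ∘ suc) (g ∘ suc))) (eq (f zero) (g zero) _ _)
  where
  eq : ∀ a b c d → a * b * (c * d) ≡ a * c * (b * d)
  eq = solve-∀

square-bound : ∀ {M x} → 0ℤ ≤ M → x * x ≤ M * M → Bounded M x
square-bound {M} {x} 0≤M x²≤M² = lower , upper M x 0≤M x²≤M²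
  where
  upper : ∀ M x → 0ℤ ≤ M → x * x ≤ M * M → x ≤ M
  upper M x 0≤M le with x ≤? M
  ... | yes x≤M = x≤M
  ... | no x≰M = *-cancelˡ-≤ (≤-<-trans 0≤M M<x) (≤-trans le (*-monoʳ-nonneg M<x))
    where
    M<x = ≰⇒> x≰M
    *-monoʳ-nonneg : M < x → M * M ≤ x * M
    *-monoʳ-nonneg M<x = by-diff _ (eq M x) (0≤* (diff (<⇒≤ M<x)) 0≤M)
      where
      eq : ∀ M x → x * M - M * M ≡ (x - M) * M
      eq = solve-∀
  neg-square : ∀ x → - x * - x ≡ x * x
  neg-square = solve-∀
  lower : - M ≤ x
  lower = ≤-trans (neg-mono-≤ (upper M (- x) 0≤M (≤-trans (≤-reflexive (neg-square x)) x²≤M²))) (≤-reflexive (neg-involutive x))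

-- Re + i Im is the product over w of C + i S s_w (for w in B) and H (for w outside B). If C + i S = H e^(iθ), then Im
-- is H^n sin(θ Σ_{w ∈ B} s_w): a bounded odd function of the sum of the signs in B.
module Sine (C S H : ℤ) where

  γ δ : Bool → ℤ
  γ b = if b then C else H
  δ b = if b then S else 0ℤ

  Re Im : ∀ {n} → (Fin n → Bool) → Vec Bool n → ℤ
  Re {zero} B [] = 1ℤ
  Re {suc n} B (σ ∷ s) = γ (B zero) * Re (B ∘ suc) s - sgn σ * δ (B zero) * Im (B ∘ suc) s
  Im {zero} B [] = 0ℤ
  Im {suc n} B (σ ∷ s) = γ (B zero) * Im (B ∘ suc) s + sgn σ * δ (B zero) * Re (B ∘ suc) s

  -- The common induction step of the correlation formulas: summing over the first sign leaves twice
  -- a constant times the same expression in the other signs.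
  𝔼-suc : ∀ {n} {f : Vec Bool (suc n) → ℤ} {g : Vec Bool n → ℤ} a {p} →
    (∀ s → f (true ∷ s) + f (false ∷ s) ≡ + 2 * a * g s) → 𝔼 n g ≡ ∣Ω∣ n * p → 𝔼 (suc n) f ≡ ∣Ω∣ (suc n) * (a * p)
  𝔼-suc {n} {f} {g} a {p} step ih = begin
    𝔼 n (λ s → f (true ∷ s) + f (false ∷ s))
      ≡⟨ trans (𝔼-cong n step) (𝔼-*ˡ n (+ 2 * a) g) ⟩
    + 2 * a * 𝔼 n g
      ≡⟨ trans (cong (+ 2 * a *_) ih) (regroup a (∣Ω∣ n) p) ⟩
    + 2 * ∣Ω∣ n * (a * p)
      ≡⟨ cong (_* (a * p)) (sym (∣Ω∣-suc n)) ⟩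
    ∣Ω∣ (suc n) * (a * p) ∎
    where
    open ≡-Reasoning
    regroup : ∀ a w p → + 2 * a * (w * p) ≡ + 2 * w * (a * p)
    regroup = solve-∀

  𝔼-Re : ∀ {n} (B : Fin n → Bool) → 𝔼 n (Re B) ≡ ∣Ω∣ n * prod (λ w → γ (B w))
  𝔼-Re {zero} B = refl
  𝔼-Re {suc n} B = 𝔼-suc {f = Re B} (γ (B zero))
    (λ s → step (γ (B zero)) (δ (B zero)) (Re (B ∘ suc) s) (Im (B ∘ suc) s)) (𝔼-Re (B ∘ suc))
    where
    step : ∀ c d R I → (c * R - 1ℤ * d * I) + (c * R - -1ℤ * d * I) ≡ + 2 * c * R
    step = solve-∀

  -- Let z = γ b + i σ δ b and z′ = γ b′ + i σ δ b′ with a random sign σ. Then `α` is the mean of z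
  -- times the conjugate of z′, and `β` that of z z′; the imaginary parts are odd in σ and cancel.
  α β : Bool → Bool → ℤ
  α b b′ = γ b * γ b′ + δ b * δ b′
  β b b′ = γ b * γ b′ - δ b * δ b′

  𝔼-conj : ∀ {n} (B B′ : Fin n → Bool) →
    𝔼 n (λ s → Re B s * Re B′ s + Im B s * Im B′ s) ≡ ∣Ω∣ n * prod (λ w → α (B w) (B′ w))
  𝔼-conj {zero} B B′ = refl
  𝔼-conj {suc n} B B′ = 𝔼-suc {f = λ s → Re B s * Re B′ s + Im B s * Im B′ s} (α (B zero) (B′ zero))
    (λ s → step (γ (B zero)) (δ (B zero)) (γ (B′ zero)) (δ (B′ zero))
      (Re (B ∘ suc) s) (Im (B ∘ suc) s) (Re (B′ ∘ suc) s) (Im (B′ ∘ suc) s)) (𝔼-conj (B ∘ suc) (B′ ∘ suc))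
    where
    step : ∀ c d c′ d′ R I R′ I′ →
      ((c * R - 1ℤ * d * I) * (c′ * R′ - 1ℤ * d′ * I′) + (c * I + 1ℤ * d * R) * (c′ * I′ + 1ℤ * d′ * R′)) +
      ((c * R - -1ℤ * d * I) * (c′ * R′ - -1ℤ * d′ * I′) + (c * I + -1ℤ * d * R) * (c′ * I′ + -1ℤ * d′ * R′)) ≡
      + 2 * (c * c′ + d * d′) * (R * R′ + I * I′)
    step = solve-∀

  𝔼-prod : ∀ {n} (B B′ : Fin n → Bool) →
    𝔼 n (λ s → Re B s * Re B′ s - Im B s * Im B′ s) ≡ ∣Ω∣ n * prod (λ w → β (B w) (B′ w))
  𝔼-prod {zero} B B′ = refl
  𝔼-prod {suc n} B B′ = 𝔼-suc {f = λ s → Re B s * Re B′ s - Im B s * Im B′ s} (β (B zero) (B′ zero))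
    (λ s → step (γ (B zero)) (δ (B zero)) (γ (B′ zero)) (δ (B′ zero))
      (Re (B ∘ suc) s) (Im (B ∘ suc) s) (Re (B′ ∘ suc) s) (Im (B′ ∘ suc) s)) (𝔼-prod (B ∘ suc) (B′ ∘ suc))
    where
    step : ∀ c d c′ d′ R I R′ I′ →
      ((c * R - 1ℤ * d * I) * (c′ * R′ - 1ℤ * d′ * I′) - (c * I + 1ℤ * d * R) * (c′ * I′ + 1ℤ * d′ * R′)) +
      ((c * R - -1ℤ * d * I) * (c′ * R′ - -1ℤ * d′ * I′) - (c * I + -1ℤ * d * R) * (c′ * I′ + -1ℤ * d′ * R′)) ≡
      + 2 * (c * c′ - d * d′) * (R * R′ - I * I′)
    step = solve-∀

  -- The formula 2 sin a sin b = cos (a - b) - cos (a + b), averaged.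
  𝔼-Im-Im : ∀ {n} (B B′ : Fin n → Bool) → + 2 * 𝔼 n (λ s → Im B s * Im B′ s) ≡
    ∣Ω∣ n * (prod (λ w → α (B w) (B′ w)) - prod (λ w → β (B w) (B′ w)))
  𝔼-Im-Im {n} B B′ = begin
    + 2 * 𝔼 n (λ s → Im B s * Im B′ s)
      ≡⟨ sym (𝔼-*ˡ n (+ 2) (λ s → Im B s * Im B′ s)) ⟩
    𝔼 n (λ s → + 2 * (Im B s * Im B′ s))
      ≡⟨ 𝔼-cong n (λ s → split (Re B s * Re B′ s) (Im B s * Im B′ s)) ⟩
    𝔼 n (λ s → (Re B s * Re B′ s + Im B s * Im B′ s) + -1ℤ * (Re B s * Re B′ s - Im B s * Im B′ s))
      ≡⟨ trans (𝔼-+ n (λ s → Re B s * Re B′ s + Im B s * Im B′ s) (λ s → -1ℤ * (Re B s * Re B′ s - Im B s * Im B′ s)))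
           (cong₂ _+_ (𝔼-conj B B′) (trans (𝔼-*ˡ n -1ℤ (λ s → Re B s * Re B′ s - Im B s * Im B′ s)) (cong (-1ℤ *_) (𝔼-prod B B′)))) ⟩
    ∣Ω∣ n * a + -1ℤ * (∣Ω∣ n * b)
      ≡⟨ collect (∣Ω∣ n) a b ⟩
    ∣Ω∣ n * (a - b) ∎
    where
    open ≡-Reasoning
    a = prod (λ w → α (B w) (B′ w))
    b = prod (λ w → β (B w) (B′ w))
    split : ∀ r i → + 2 * i ≡ (r + i) + -1ℤ * (r - i)
    split = solve-∀
    collect : ∀ w a b → w * a + -1ℤ * (w * b) ≡ w * (a - b)
    collect = solve-∀

  -- The product of all `γ (B w)` with the factor at u replaced by `δ (B u)`: the sign of u
  -- correlates only with the part of its own factor that is odd in it.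
  marked : ∀ {n} → (Fin n → Bool) → Fin n → ℤ
  marked {suc n} B zero = δ (B zero) * prod (λ w → γ (B (suc w)))
  marked {suc n} B (suc u) = γ (B zero) * marked (B ∘ suc) u

  𝔼-sgn-Im : ∀ {n} (B : Fin n → Bool) u → 𝔼 n (λ s → signs s u * Im B s) ≡ ∣Ω∣ n * marked B u
  𝔼-sgn-Im {suc n} B zero = 𝔼-suc {f = λ s → signs s zero * Im B s} (δ (B zero))
    (λ s → step (γ (B zero)) (δ (B zero)) (Re (B ∘ suc) s) (Im (B ∘ suc) s)) (𝔼-Re (B ∘ suc))
    where
    step : ∀ c d R I → 1ℤ * (c * I + 1ℤ * d * R) + -1ℤ * (c * I + -1ℤ * d * R) ≡ + 2 * d * R
    step = solve-∀
  𝔼-sgn-Im {suc n} B (suc u) = 𝔼-suc {f = λ s → signs s (suc u) * Im B s} (γ (B zero))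
    (λ s → step (γ (B zero)) (δ (B zero)) (signs s u) (Re (B ∘ suc) s) (Im (B ∘ suc) s)) (𝔼-sgn-Im (B ∘ suc) u)
    where
    step : ∀ c d x R I → x * (c * I + 1ℤ * d * R) + x * (c * I + -1ℤ * d * R) ≡ + 2 * c * (x * I)
    step = solve-∀

  marked-outside : ∀ {n} (B : Fin n → Bool) u → B u ≡ false → marked B u ≡ 0ℤ
  marked-outside {suc n} B zero Bu rewrite Bu = *-zeroˡ (prod λ w → γ (B (suc w)))
  marked-outside {suc n} B (suc u) Bu = trans (cong (γ (B zero) *_) (marked-outside (B ∘ suc) u Bu)) (*-zeroʳ (γ (B zero)))

  module Bounds (0≤S : 0ℤ ≤ S) (0≤C : 0ℤ ≤ C) (C≤H : C ≤ H) (S≤C : S ≤ C) (pythagoras : C * C + S * S ≡ H * H) where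

    0≤H : 0ℤ ≤ H
    0≤H = ≤-trans 0≤C C≤H

    0≤γ : ∀ b → 0ℤ ≤ γ b
    0≤γ true = 0≤C
    0≤γ false = 0≤H

    γ≤H : ∀ b → γ b ≤ H
    γ≤H true = C≤H
    γ≤H false = ≤-refl

    marked-inside : ∀ {n} (B : Fin n → Bool) u → B u ≡ true → S * prod (λ w → γ (B w)) ≤ H * marked B u
    marked-inside {suc n} B zero Bu rewrite Bu = by-diff _ (eq C S H (prod λ w → γ (B (suc w))))
      (0≤* (diff C≤H) (0≤* 0≤S (prod-nonneg λ w → 0≤γ (B (suc w)))))
      where
      eq : ∀ C S H p → H * (S * p) - S * (C * p) ≡ (H - C) * (S * p)
      eq = solve-∀
    marked-inside {suc n} B (suc u) Bu = by-diff _ (eq S H (γ (B zero)) (prod λ w → γ (B (suc w))) (marked (B ∘ suc) u))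
      (0≤* (0≤γ (B zero)) (diff (marked-inside (B ∘ suc) u Bu)))
      where
      eq : ∀ S H g p m → H * (g * m) - S * (g * p) ≡ g * (H * m - S * p)
      eq = solve-∀

    γ²+δ² : ∀ b → γ b * γ b + δ b * δ b ≡ H * H
    γ²+δ² true = pythagoras
    γ²+δ² false = +-identityʳ (H * H)

    modulus : ∀ {n} (B : Fin n → Bool) s → Re B s * Re B s + Im B s * Im B s ≡ pow n H * pow n H
    modulus {zero} B [] = refl
    modulus {suc n} B (σ ∷ s) = begin
      _
        ≡⟨ expand (γ (B zero)) (sgn σ) (δ (B zero)) (Re (B ∘ suc) s) (Im (B ∘ suc) s) ⟩
      (γ (B zero) * γ (B zero) + sgn σ * sgn σ * (δ (B zero) * δ (B zero))) * (Re (B ∘ suc) s * Re (B ∘ suc) s + Im (B ∘ suc) s * Im (B ∘ suc) s)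
        ≡⟨ cong₂ _*_ (trans (cong (λ z → γ (B zero) * γ (B zero) + z)
               (trans (cong (_* (δ (B zero) * δ (B zero))) (sgn² σ)) (*-identityˡ (δ (B zero) * δ (B zero))))) (γ²+δ² (B zero)))
             (modulus (B ∘ suc) s) ⟩
      H * H * (pow n H * pow n H)
        ≡⟨ regroup H (pow n H) ⟩
      pow (suc n) H * pow (suc n) H ∎
      where
      open ≡-Reasoning
      sgn² : ∀ σ → sgn σ * sgn σ ≡ 1ℤ
      sgn² true = refl
      sgn² false = refl
      expand : ∀ c x d R I → (c * R - x * d * I) * (c * R - x * d * I) + (c * I + x * d * R) * (c * I + x * d * R) ≡
        (c * c + x * x * (d * d)) * (R * R + I * I)
      expand = solve-∀
      regroup : ∀ H p → H * H * (p * p) ≡ H * p * (H * p)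
      regroup = solve-∀

    Im-bounded : ∀ {n} (B : Fin n → Bool) s → Bounded (pow n H) (Im B s)
    Im-bounded {n} B s = square-bound (prod-nonneg {n} λ _ → 0≤H)
      (by-diff _ (trans (cong (_- Im B s * Im B s) (sym (modulus B s))) (eq (Re B s) (Im B s))) (square-nonneg (Re B s)))
      where
      eq : ∀ R I → R * R + I * I - I * I ≡ R * R
      eq = solve-∀
      square-nonneg : ∀ x → 0ℤ ≤ x * x
      square-nonneg (+ m) = 0≤* {+ m} {+ m} 0≤+ℕ 0≤+ℕ
      square-nonneg -[1+ m ] = 0≤+ℕ

    -- Bernoulli's inequality: the b-th power of cos θ is at least 1 - b (1 - cos θ), with
    -- denominators cleared.
    γ-product : ∀ {n} (B : Fin n → Bool) → H * (pow n H - prod (λ w → γ (B w))) ≤ pow n H * ((H - C) * size B)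
    γ-product {n} B = ≤-trans (prod-gap H (λ _ → H) (λ w → γ (B w)) (λ w → 0≤γ (B w)) (λ w → γ≤H (B w)) (λ _ → ≤-refl))
      (≤-reflexive (cong (pow n H *_) (trans (sum-cong-≗ λ w → defect (B w)) (sum-*ˡ (H - C) (λ w → ι (B w))))))
      where
      defect : ∀ b → H - γ b ≡ (H - C) * ι b
      defect true = sym (*-identityʳ (H - C))
      defect false = trans (+-inverseʳ H) (sym (*-zeroʳ (H - C)))

    -- The two products in `𝔼-Im-Im` differ only in the factors at common elements of B and B′, each
    -- time by 2 S S. By `prod-gap` the correlation is at most sin² θ per common element; S ≤ C
    -- keeps the factors nonnegative.
    correlation : ∀ {n} (B B′ : Fin n → Bool) → H * H * 𝔼 n (λ s → Im B s * Im B′ s) ≤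
      ∣Ω∣ n * (pow n (H * H) * (S * S * sum (λ w → ι (B w) * ι (B′ w))))
    correlation {n} B B′ = *-cancelˡ-≤ {+ 2} (+<+ (ℕ.s≤s ℕ.z≤n)) (≤-trans
      (≤-reflexive (trans (swap (H * H) X) (trans (cong (H * H *_) (𝔼-Im-Im B B′)) (assoc (H * H) (∣Ω∣ n) (prod a - prod b)))))
      (≤-trans (*-monoˡ (<⇒≤ (∣Ω∣-positive n))
          (prod-gap (H * H) a b (λ w → 0≤β (B w) (B′ w)) (λ w → β≤α (B w) (B′ w)) (λ w → α≤H² (B w) (B′ w))))
        (≤-reflexive (trans (cong (λ z → ∣Ω∣ n * (pow n (H * H) * z)) defects)
          (double (∣Ω∣ n) (pow n (H * H)) (S * S * sum (λ w → ι (B w) * ι (B′ w))))))))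
      where
      X = 𝔼 n λ s → Im B s * Im B′ s
      a b : Fin n → ℤ
      a w = α (B w) (B′ w)
      b w = β (B w) (B′ w)
      swap : ∀ h x → + 2 * (h * x) ≡ h * (+ 2 * x)
      swap = solve-∀
      assoc : ∀ h w x → h * (w * x) ≡ w * (h * x)
      assoc = solve-∀
      double : ∀ w p z → w * (p * (+ 2 * z)) ≡ + 2 * (w * (p * z))
      double = solve-∀
      0≤δ : ∀ b → 0ℤ ≤ δ b
      0≤δ true = 0≤S
      0≤δ false = ≤-refl
      δ≤γ : ∀ b → δ b ≤ γ b
      δ≤γ true = S≤C
      δ≤γ false = 0≤H
      0≤β : ∀ b b′ → 0ℤ ≤ β b b′
      0≤β b b′ = by-diff _ (eq (γ b) (γ b′) (δ b) (δ b′)) (0≤+ (0≤* (diff (δ≤γ b)) (0≤γ b′)) (0≤* (0≤δ b) (diff (δ≤γ b′))))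
        where
        eq : ∀ c c′ d d′ → (c * c′ - d * d′) - 0ℤ ≡ (c - d) * c′ + d * (c′ - d′)
        eq = solve-∀
      β≤α : ∀ b b′ → β b b′ ≤ α b b′
      β≤α b b′ = by-diff _ (eq (γ b * γ b′) (δ b * δ b′)) (0≤+ (0≤* (0≤δ b) (0≤δ b′)) (0≤* (0≤δ b) (0≤δ b′)))
        where
        eq : ∀ c d → (c + d) - (c - d) ≡ d + d
        eq = solve-∀
      α≤H² : ∀ b b′ → α b b′ ≤ H * H
      α≤H² true true = ≤-reflexive pythagoras
      α≤H² true false = by-diff _ (eq C S H) (0≤* 0≤H (diff C≤H))
        where
        eq : ∀ C S H → H * H - (C * H + S * 0ℤ) ≡ H * (H - C)
        eq = solve-∀
      α≤H² false true = by-diff _ (eq C S H) (0≤* 0≤H (diff C≤H))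
        where
        eq : ∀ C S H → H * H - (H * C + 0ℤ * S) ≡ H * (H - C)
        eq = solve-∀
      α≤H² false false = ≤-reflexive (+-identityʳ (H * H))
      defect : ∀ b b′ → α b b′ - β b b′ ≡ + 2 * (S * S) * (ι b * ι b′)
      defect true true = eq C S
        where
        eq : ∀ C S → (C * C + S * S) - (C * C - S * S) ≡ + 2 * (S * S) * (1ℤ * 1ℤ)
        eq = solve-∀
      defect true false = eq C S H
        where
        eq : ∀ C S H → (C * H + S * 0ℤ) - (C * H - S * 0ℤ) ≡ + 2 * (S * S) * (1ℤ * 0ℤ)
        eq = solve-∀
      defect false true = eq C S H
        where
        eq : ∀ C S H → (H * C + 0ℤ * S) - (H * C - 0ℤ * S) ≡ + 2 * (S * S) * (0ℤ * 1ℤ)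
        eq = solve-∀
      defect false false = eq C S H
        where
        eq : ∀ C S H → (H * H + 0ℤ * 0ℤ) - (H * H - 0ℤ * 0ℤ) ≡ + 2 * (S * S) * (0ℤ * 0ℤ)
        eq = solve-∀
      defects : sum (λ w → a w - b w) ≡ + 2 * (S * S * sum (λ w → ι (B w) * ι (B′ w)))
      defects = trans (sum-cong-≗ λ w → defect (B w) (B′ w)) (trans (sum-*ˡ (+ 2 * (S * S)) (λ w → ι (B w) * ι (B′ w)))
        (*-assoc (+ 2) (S * S) (sum λ w → ι (B w) * ι (B′ w))))

-- Responding to the signs of neighbours

*-positive : ∀ {x y} → 0ℤ < x → 0ℤ < y → 0ℤ < x * y
*-positive {+ suc a} {y} (+<+ _) 0<y = subst (_< + suc a * y) (*-zeroʳ (+ suc a)) (*-monoˡ-<-pos (+ suc a) 0<y)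

prod-positive : ∀ {n} {f : Fin n → ℤ} → (∀ i → 0ℤ < f i) → 0ℤ < prod f
prod-positive {zero} _ = +<+ (ℕ.s≤s ℕ.z≤n)
prod-positive {suc n} {f} 0<f = *-positive (0<f zero) (prod-positive (0<f ∘ suc))

𝔼-sgn-sgn : ∀ {n} (u v : Fin n) → u ≢ v → 𝔼 n (λ s → signs s u * signs s v) ≡ 0ℤ
𝔼-sgn-sgn zero zero u≢v = ⊥-elim (u≢v refl)
𝔼-sgn-sgn {suc n} zero (suc v) _ = trans (𝔼-cong n λ s → cancel (signs s v)) (𝔼-const n 0ℤ)
  where
  cancel : ∀ x → 1ℤ * x + -1ℤ * x ≡ 0ℤ
  cancel = solve-∀
𝔼-sgn-sgn {suc n} (suc u) zero _ = trans (𝔼-cong n λ s → cancel (signs s u)) (𝔼-const n 0ℤ)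
  where
  cancel : ∀ x → x * 1ℤ + x * -1ℤ ≡ 0ℤ
  cancel = solve-∀
𝔼-sgn-sgn {suc n} (suc u) (suc v) u≢v = trans (𝔼-+ n (λ s → signs s u * signs s v) (λ s → signs s u * signs s v))
  (cong₂ _+_ ih ih)
  where
  ih = 𝔼-sgn-sgn u v (u≢v ∘ cong suc)

-- Shearer's argument with response angle 1/K: v opposes the signs in B v through a bounded odd function of their sum.
module Respond {n} (G : Graph n) (B : Fin n → Fin n → Bool) (inside : ∀ v u → B v u ≡ true → adj G v u ≡ true)
  (K k : ℤ) (1≤K : 1ℤ ≤ K) (k≤K² : k ≤ K * K) (out-degree : ∀ v → size (B v) ≤ k) where

  -- The Pythagorean triple m² - 1, 2 m, m² + 1 with m = 4 K. Its angle is 2 arctan (1 / (4 K)),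
  -- close to 1 / (2 K).
  C S H : ℤ
  C = + 16 * K * K - 1ℤ
  S = + 8 * K
  H = + 16 * K * K + 1ℤ

  0≤K : 0ℤ ≤ K
  0≤K = ≤-trans 0≤+ℕ 1≤K

  0≤K-1 : 0ℤ ≤ K - 1ℤ
  0≤K-1 = diff 1≤K

  0≤S : 0ℤ ≤ S
  0≤S = 0≤* {+ 8} 0≤+ℕ 0≤K

  S≤C : S ≤ C
  S≤C = by-diff _ (eq K) (0≤+ (0≤* (0≤* {+ 16} 0≤+ℕ 0≤K-1) 0≤K-1) (0≤+ (0≤* {+ 24} 0≤+ℕ 0≤K-1) (0≤+ℕ {7})))
    where
    eq : ∀ K → (+ 16 * K * K - 1ℤ) - + 8 * K ≡ + 16 * (K - 1ℤ) * (K - 1ℤ) + (+ 24 * (K - 1ℤ) + + 7)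
    eq = solve-∀

  C≤H : C ≤ H
  C≤H = by-diff (+ 2) (eq K) 0≤+ℕ
    where
    eq : ∀ K → (+ 16 * K * K + 1ℤ) - (+ 16 * K * K - 1ℤ) ≡ + 2
    eq = solve-∀

  pythagoras : C * C + S * S ≡ H * H
  pythagoras = eq K
    where
    eq : ∀ K → (+ 16 * K * K - 1ℤ) * (+ 16 * K * K - 1ℤ) + + 8 * K * (+ 8 * K) ≡ (+ 16 * K * K + 1ℤ) * (+ 16 * K * K + 1ℤ)
    eq = solve-∀

  open Sine C S H
  open Bounds 0≤S (≤-trans 0≤S S≤C) C≤H S≤C pythagoras

  0<H : 0ℤ < H
  0<H = <-≤-trans (+<+ (ℕ.s≤s ℕ.z≤n)) (by-diff _ (eq K) (0≤* (0≤* {+ 16} 0≤+ℕ 0≤K) 0≤K))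
    where
    eq : ∀ K → (+ 16 * K * K + 1ℤ) - 1ℤ ≡ + 16 * K * K
    eq = solve-∀

  N W M : ℤ
  N = pow n H
  W = ∣Ω∣ n
  M = sum λ v → size (B v)

  0<N : 0ℤ < N
  0<N = prod-positive {n} λ _ → 0<H

  0≤N : 0ℤ ≤ N
  0≤N = <⇒≤ 0<N

  0≤W : 0ℤ ≤ W
  0≤W = <⇒≤ (∣Ω∣-positive n)

  c : Fin n → Fin n → ℤ
  c u v = sum λ w → ι (B u w) * ι (B v w)

  -- Since 1 - cos θ = 2 / H and `B v` has at most K K elements, Bernoulli's inequality keeps the
  -- product of cosines above 1/2. Large response sets thus do not wash out the correlation with a
  -- single sign.
  N≤2prod : ∀ v → N ≤ + 2 * prod (λ w → γ (B v w))
  N≤2prod v = *-cancelˡ-≤ 0<H (by-diff _ (eq K N (prod λ w → γ (B v w)) (size (B v)) k)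
    (0≤+ (0≤* {+ 2} 0≤+ℕ (diff (γ-product (B v)))) (0≤* 0≤N (0≤+ (0≤* {+ 4} 0≤+ℕ (diff (out-degree v)))
      (0≤+ (0≤* {+ 4} 0≤+ℕ (diff k≤K²)) (0≤+ (0≤* (0≤* {+ 12} 0≤+ℕ 0≤K) 0≤K) (0≤+ℕ {1})))))))
    where
    eq : ∀ K N P b k → (+ 16 * K * K + 1ℤ) * (+ 2 * P) - (+ 16 * K * K + 1ℤ) * N ≡
      + 2 * (N * (((+ 16 * K * K + 1ℤ) - (+ 16 * K * K - 1ℤ)) * b) - (+ 16 * K * K + 1ℤ) * (N - P)) +
      N * (+ 4 * (k - b) + (+ 4 * (K * K - k) + (+ 12 * K * K + 1ℤ)))
    eq = solve-∀

  marked≥ : ∀ v u → ι (B v u) * (S * N) ≤ + 2 * (H * marked (B v) u)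
  marked≥ v u with B v u in vu
  ... | false = ≤-reflexive (sym (trans (cong (λ z → + 2 * (H * z)) (marked-outside (B v) u vu)) (cong (+ 2 *_) (*-zeroʳ H))))
  ... | true = by-diff _ (eq S N H (prod λ w → γ (B v w)) (marked (B v) u))
    (0≤+ (0≤* 0≤S (diff (N≤2prod v))) (0≤* {+ 2} 0≤+ℕ (diff (marked-inside (B v) u vu))))
    where
    eq : ∀ S N H P m → + 2 * (H * m) - 1ℤ * (S * N) ≡ S * (+ 2 * P - N) + + 2 * (H * m - S * P)
    eq = solve-∀

  x : Vec Bool n → Fin n → ℤ
  x s v = N * signs s v + -1ℤ * Im (B v) s

  x-bounded : ∀ s v → Bounded (N + N) (x s v)
  x-bounded s v = add (bounded-sgn (lookup s v) self) (subst (Bounded N) (negated (Im (B v) s)) (bounded-neg (Im-bounded (B v) s)))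
    where
    self : Bounded N N
    self = ≤-trans (neg-mono-≤ 0≤N) 0≤N , ≤-refl
    negated : ∀ z → - z ≡ -1ℤ * z
    negated = solve-∀
    add : ∀ {L M y z} → Bounded L y → Bounded M z → Bounded (L + M) (y + z)
    add {L} {M} (lo₁ , hi₁) (lo₂ , hi₂) = ≤-trans (≤-reflexive (neg-distrib-+ L M)) (+-mono-≤ lo₁ lo₂) , +-mono-≤ hi₁ hi₂

  𝔼-xx : ∀ u v → u ≢ v → 𝔼 n (λ s → x s u * x s v) ≡
    𝔼 n (λ s → Im (B u) s * Im (B v) s) + -1ℤ * (N * (W * marked (B v) u + W * marked (B u) v))
  𝔼-xx u v u≢v = begin
    𝔼 n (λ s → x s u * x s v)
      ≡⟨ 𝔼-cong n (λ s → expand N (signs s u) (signs s v) (Im (B u) s) (Im (B v) s)) ⟩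
    𝔼 n (λ s → (f s + - N * (g s + h s)) + N * N * σσ s)
      ≡⟨ trans (𝔼-+ n (λ s → f s + - N * (g s + h s)) (λ s → N * N * σσ s)) (cong₂ _+_
           (trans (𝔼-+ n f (λ s → - N * (g s + h s))) (cong (λ z → 𝔼 n f + z)
             (trans (𝔼-*ˡ n (- N) (λ s → g s + h s)) (cong (λ z → - N * z) (𝔼-+ n g h)))))
           (trans (𝔼-*ˡ n (N * N) σσ) (cong (N * N *_) (𝔼-sgn-sgn u v u≢v)))) ⟩
    𝔼 n f + - N * (𝔼 n g + 𝔼 n h) + N * N * 0ℤ
      ≡⟨ cong₂ (λ y z → 𝔼 n f + - N * (y + z) + N * N * 0ℤ) (𝔼-sgn-Im (B v) u) (𝔼-sgn-Im (B u) v) ⟩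
    𝔼 n f + - N * (W * marked (B v) u + W * marked (B u) v) + N * N * 0ℤ
      ≡⟨ tidy (𝔼 n f) N (W * marked (B v) u + W * marked (B u) v) ⟩
    _ ∎
    where
    open ≡-Reasoning
    f g h σσ : Vec Bool n → ℤ
    f s = Im (B u) s * Im (B v) s
    g s = signs s u * Im (B v) s
    h s = signs s v * Im (B u) s
    σσ s = signs s u * signs s v
    expand : ∀ N p q a b → (N * p + -1ℤ * a) * (N * q + -1ℤ * b) ≡ (a * b + - N * (p * b + q * a)) + N * N * (p * q)
    expand = solve-∀
    tidy : ∀ f N g → f + - N * g + N * N * 0ℤ ≡ f + -1ℤ * (N * g)
    tidy = solve-∀

  -- On an edge the two own signs are uncorrelated. A pair in B earns at least sin θ / 2, by
  -- `marked≥`, and a common element of `B u` and `B v` costs at most sin² θ.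
  edge : ∀ u v → + 2 * (H * H) * (ι (adj G u v) * 𝔼 n (λ s → x s u * x s v)) ≤
    W * (N * N) * (+ 2 * (S * S) * (ι (adj G u v) * c u v) + - (H * S) * (ι (B v u) + ι (B u v)))
  edge u v with adj G u v in uv
  ... | false = ≤-reflexive (trans (zero₁ (H * H) (𝔼 n λ s → x s u * x s v)) (sym (trans
      (cong₂ (λ y z → W * (N * N) * (+ 2 * (S * S) * (0ℤ * c u v) + - (H * S) * (y + z))) vu≡0 uv≡0)
      (zero₂ (W * (N * N)) (S * S) (c u v) (H * S)))))
    where
    zero₁ : ∀ h e → + 2 * h * (0ℤ * e) ≡ 0ℤ
    zero₁ = solve-∀
    zero₂ : ∀ w s c h → w * (+ 2 * s * (0ℤ * c) + - h * (0ℤ + 0ℤ)) ≡ 0ℤ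
    zero₂ = solve-∀
    none : ∀ a b → adj G a b ≡ false → ι (B a b) ≡ 0ℤ
    none a b ab with B a b in Bab
    ... | false = refl
    ... | true with trans (sym ab) (inside a b Bab)
    ... | ()
    uv≡0 = none u v uv
    vu≡0 = none v u (trans (Graph.sym G v u) uv)
  ... | true = by-diff _ (trans
      (cong (λ z → W * (N * N) * (+ 2 * (S * S) * (1ℤ * c u v) + - (H * S) * (ι (B v u) + ι (B u v))) - + 2 * (H * H) * (1ℤ * z)) (𝔼-xx u v u≢v))
      (eq W N H S (c u v) (𝔼 n λ s → Im (B u) s * Im (B v) s) (marked (B v) u) (marked (B u) v) (ι (B v u)) (ι (B u v))))
    (0≤+ (0≤* {+ 2} 0≤+ℕ (diff corr)) (0≤* (0≤* (0≤* 0≤W 0≤N) (<⇒≤ 0<H)) (0≤+ (diff (marked≥ v u)) (diff (marked≥ u v)))))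
    where
    u≢v : u ≢ v
    u≢v refl with trans (sym uv) (irrefl G u)
    ... | ()
    corr : H * H * 𝔼 n (λ s → Im (B u) s * Im (B v) s) ≤ W * (N * N * (S * S * c u v))
    corr = subst (λ z → H * H * 𝔼 n (λ s → Im (B u) s * Im (B v) s) ≤ W * (z * (S * S * c u v))) (prod-* {n} (λ _ → H) (λ _ → H)) (correlation (B u) (B v))
    eq : ∀ W N H S c e m m′ i j → W * (N * N) * (+ 2 * (S * S) * (1ℤ * c) + - (H * S) * (i + j)) -
      + 2 * (H * H) * (1ℤ * (e + -1ℤ * (N * (W * m + W * m′)))) ≡
      + 2 * (W * (N * N * (S * S * c)) - H * H * e) + W * N * H * ((+ 2 * (H * m) - i * (S * N)) + (+ 2 * (H * m′) - j * (S * N)))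
    eq = solve-∀

  -- In total the gain is 2 H S M and the cost at most 2 S S K M. Since S K = 8 K K is less than
  -- half of H, half of the gain survives, which gives K M ≤ H T.
  respond : ∀ {T} → Surplus≤ G T → sum (λ u → sum λ v → ι (adj G u v) * c u v) ≤ K * M → M ≤ + 17 * K * T
  respond {T} surplus conflict = *-cancelˡ-≤ 0<K (by-diff _ (last-step K T M) (0≤+ SM≤ (0≤* 0≤T (0≤+ (0≤* 0≤K-1 0≤K) 0≤K-1))))
    where
    0<K : 0ℤ < K
    0<K = <-≤-trans (+<+ (ℕ.s≤s ℕ.z≤n)) 1≤K
    0≤T : 0ℤ ≤ T
    0≤T = surplus-nonneg G {T} surplus
    0≤M : 0ℤ ≤ M
    0≤M = sum-nonneg λ v → sum-nonneg λ u → 0≤ι (B v u)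
    last-step : ∀ K T M → K * (+ 17 * K * T) - K * M ≡
      ((+ 16 * K * K + 1ℤ) * T - K * M) + T * ((K - 1ℤ) * K + (K - 1ℤ))
    last-step = solve-∀
    a : Fin n → Fin n → ℤ
    a u v = ι (adj G u v)
    A = sum λ u → sum λ v → a u v * 𝔼 n (λ s → x s u * x s v)
    Conf = sum λ u → sum λ v → a u v * c u v
    average : 0ℤ ≤ (N + N) * (N + N) * T * W + A
    average = subst (0ℤ ≤_) (trans (𝔼-+ n (λ _ → (N + N) * (N + N) * T) (λ s → quad G (x s)))
        (cong₂ _+_ (𝔼-const n ((N + N) * (N + N) * T)) (𝔼-quad n G x)))
      (𝔼-nonneg n λ s → rounding G {T} (N + N) (x s) surplus (+-mono-< 0<N 0<N) (x-bounded s))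
    A≤ : + 2 * (H * H) * A ≤ W * (N * N) * (+ 2 * (S * S) * Conf + - (H * S) * (M + M))
    A≤ = ≤-trans (≤-reflexive (sym (sum₂-*ˡ (+ 2 * (H * H)) (λ u v → a u v * 𝔼 n (λ s → x s u * x s v)))))
      (≤-trans (sum₂-mono edge) (≤-reflexive (trans (sum₂-*ˡ (W * (N * N))
          (λ u v → + 2 * (S * S) * (a u v * c u v) + - (H * S) * (ι (B v u) + ι (B u v))))
        (cong (W * (N * N) *_) (trans (sum₂-+ (λ u v → + 2 * (S * S) * (a u v * c u v)) (λ u v → - (H * S) * (ι (B v u) + ι (B u v))))
          (cong₂ _+_ (sum₂-*ˡ (+ 2 * (S * S)) (λ u v → a u v * c u v)) (trans (sum₂-*ˡ (- (H * S)) (λ u v → ι (B v u) + ι (B u v)))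
            (cong (- (H * S) *_) (trans (sum₂-+ (λ u v → ι (B v u)) (λ u v → ι (B u v))) (cong (_+ M) (∑-comm λ u v → ι (B v u))))))))))))
    balance : 0ℤ ≤ W * (N * N) * (+ 8 * (H * H) * T + (+ 2 * (S * S) * Conf + - (H * S) * (M + M)))
    balance = subst (0ℤ ≤_) (eq H W N T A (+ 2 * (S * S) * Conf + - (H * S) * (M + M)))
      (0≤+ (0≤* (0≤* {+ 2} 0≤+ℕ (0≤* (<⇒≤ 0<H) (<⇒≤ 0<H))) average) (diff A≤))
      where
      eq : ∀ H W N T A X → + 2 * (H * H) * ((N + N) * (N + N) * T * W + A) + (W * (N * N) * X - + 2 * (H * H) * A) ≡
        W * (N * N) * (+ 8 * (H * H) * T + X)
      eq = solve-∀
    0<WNN : 0ℤ < W * (N * N)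
    0<WNN = *-positive (∣Ω∣-positive n) (*-positive 0<N 0<N)
    SM≤ : 0ℤ ≤ (+ 16 * K * K + 1ℤ) * T - K * M
    SM≤ = *-cancelˡ-nonneg 0<H (*-cancelˡ-nonneg {+ 8} (+<+ (ℕ.s≤s ℕ.z≤n)) (by-diff _ (eq K T M Conf)
      (0≤+ (*-cancelˡ-nonneg 0<WNN balance) (0≤+ (0≤* (0≤* {+ 2} 0≤+ℕ (0≤* 0≤S 0≤S)) (diff conflict)) (0≤* 0≤S 0≤M)))))
      where
      eq : ∀ K T M F → + 8 * ((+ 16 * K * K + 1ℤ) * ((+ 16 * K * K + 1ℤ) * T - K * M)) - 0ℤ ≡
        (+ 8 * ((+ 16 * K * K + 1ℤ) * (+ 16 * K * K + 1ℤ)) * T + (+ 2 * (+ 8 * K * (+ 8 * K)) * F +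
          - ((+ 16 * K * K + 1ℤ) * (+ 8 * K)) * (M + M))) + (+ 2 * (+ 8 * K * (+ 8 * K)) * (K * M - F) + + 8 * K * M)
      eq = solve-∀

-- Graphs of small out-degree

same : ∀ {n} → Fin n → Fin n → Bool
same i j = does (i Fin.≟ j)

same-refl : ∀ {n} (i : Fin n) → same i i ≡ true
same-refl i with i Fin.≟ i
... | yes _ = refl
... | no i≢i = ⊥-elim (i≢i refl)

same-sym : ∀ {n} (i j : Fin n) → same i j ≡ same j i
same-sym i j with i Fin.≟ j | j Fin.≟ i
... | yes _ | yes _ = refl
... | no _ | no _ = refl
... | yes i≡j | no j≢i = ⊥-elim (j≢i (sym i≡j))
... | no i≢j | yes j≡i = ⊥-elim (i≢j (sym j≡i))

sum-same : ∀ {n} (a : Fin n) → sum (λ j → ι (same j a)) ≡ 1ℤ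
sum-same {suc n} zero = cong (_+_ 1ℤ) (sum-zero {n} λ _ → refl)
sum-same {suc n} (suc a) = trans (+-identityˡ (sum λ j → ι (same j a))) (sum-same a)

below-average : ∀ {t} (f : Fin t → ℤ) → 0ℤ < + t → ∃ λ j → + t * f j ≤ sum f
below-average {t} f 0<t = j , 0≤i-j⇒j≤i (≤-trans (diff (i<j⇒suc[i]≤j 0<)) (≤-reflexive (eq (sum f) (+ t) (f j))))
  where
  -- The summand 1 makes the total equal to t, hence positive; for integers, h j > 0 is the desired
  -- non-strict inequality.
  h : Fin t → ℤ
  h j = sum f + (- (+ t)) * f j + 1ℤ
  total : sum h ≡ + t
  total = trans (trans (sum-+ (λ j → sum f + (- (+ t)) * f j) (λ _ → 1ℤ)) (cong₂ _+_ (trans (sum-+ (λ _ → sum f) (λ j → (- (+ t)) * f j))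
    (cong₂ _+_ (sum-const t (sum f)) (sum-*ˡ (- (+ t)) f))) (sum-const t 1ℤ))) (simplify (+ t) (sum f))
    where
    simplify : ∀ t s → t * s + (- t) * s + t * 1ℤ ≡ t
    simplify = solve-∀
  found = sum-positive {t} {h} (subst (0ℤ <_) (sym total) 0<t)
  j = proj₁ found
  0< = proj₂ found
  eq : ∀ s t x → s + (- t) * x + 1ℤ - 1ℤ ≡ s - t * x
  eq = solve-∀

-- A random colouring derandomised: each vertex takes a colour of at most average clash with the
-- vertices coloured before it.
colouring : ∀ {n} t (ψ : Fin n → Fin n → ℤ) → 0ℤ < + t → (∀ v → ψ v v ≡ 0ℤ) →
  Σ (Fin n → Fin t) λ c → + t * sum (λ v → sum λ w → ψ v w * ι (same (c v) (c w))) ≤ sum λ v → sum (ψ v)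
colouring {zero} t ψ _ _ = (λ ()) , ≤-reflexive (*-zeroʳ (+ t))
colouring {suc n} t ψ 0<t diag = extend (colouring {n} t (λ v w → ψ (suc v) (suc w)) 0<t (diag ∘ suc))
  where
  open ≡-Reasoning
  ψ′ : Fin n → Fin n → ℤ
  ψ′ v w = ψ (suc v) (suc w)
  φ : Fin n → ℤ
  φ w = ψ zero (suc w) + ψ (suc w) zero
  extend : (Σ (Fin n → Fin t) λ c → + t * sum (λ v → sum λ w → ψ′ v w * ι (same (c v) (c w))) ≤ sum λ v → sum (ψ′ v)) →
    Σ (Fin (suc n) → Fin t) λ c → + t * sum (λ v → sum λ w → ψ v w * ι (same (c v) (c w))) ≤ sum λ v → sum (ψ v)
  extend (c , rest) = c′ , subst₂ _≤_ (sym left) (sym right) (+-mono-≤ (≤-trans (proj₂ choice) (≤-reflexive weight)) rest)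
    where
    clash : Fin t → ℤ
    clash j = sum λ w → φ w * ι (same j (c w))
    choice = below-average clash 0<t
    j = proj₁ choice
    c′ : Fin (suc n) → Fin t
    c′ zero = j
    c′ (suc v) = c v
    R = sum λ v → sum λ w → ψ′ v w * ι (same (c v) (c w))
    weight : sum clash ≡ sum φ
    weight = trans (∑-comm λ j w → φ w * ι (same j (c w))) (sum-cong-≗ λ w →
      trans (sum-*ˡ (φ w) (λ j → ι (same j (c w)))) (trans (cong (φ w *_) (sum-same (c w))) (*-identityʳ (φ w))))
    mono : sum (λ v → sum λ w → ψ v w * ι (same (c′ v) (c′ w))) ≡ clash j + R
    mono = begin
      ψ zero zero * ι (same j j) + X + sum (λ v → ψ (suc v) zero * ι (same (c v) j) + Y v)
        ≡⟨ cong₂ (λ y z → y * ι (same j j) + X + z) (diag zero) (sum-+ (λ v → ψ (suc v) zero * ι (same (c v) j)) Y) ⟩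
      0ℤ * ι (same j j) + X + (Z + R)
        ≡⟨ tidy (ι (same j j)) X Z R ⟩
      X + Z + R
        ≡⟨ cong (λ z → X + z + R) (sum-cong-≗ λ v → cong (λ b → ψ (suc v) zero * ι b) (same-sym (c v) j)) ⟩
      X + sum (λ v → ψ (suc v) zero * ι (same j (c v))) + R
        ≡⟨ cong (_+ R) (sym (trans (sum-cong-≗ λ w → *-distribʳ-+ (ι (same j (c w))) (ψ zero (suc w)) (ψ (suc w) zero))
             (sum-+ (λ w → ψ zero (suc w) * ι (same j (c w))) (λ w → ψ (suc w) zero * ι (same j (c w)))))) ⟩
      clash j + R ∎
      where
      X = sum λ w → ψ zero (suc w) * ι (same j (c w))
      Y : Fin n → ℤ
      Y v = sum λ w → ψ′ v w * ι (same (c v) (c w))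
      Z = sum λ v → ψ (suc v) zero * ι (same (c v) j)
      tidy : ∀ i x z r → 0ℤ * i + x + (z + r) ≡ x + z + r
      tidy = solve-∀
    left : + t * sum (λ v → sum λ w → ψ v w * ι (same (c′ v) (c′ w))) ≡ + t * clash j + + t * R
    left = trans (cong (+ t *_) mono) (*-distribˡ-+ (+ t) (clash j) R)
    right : sum (λ v → sum (ψ v)) ≡ sum φ + sum (λ v → sum (ψ′ v))
    right = begin
      ψ zero zero + X + sum (λ v → ψ (suc v) zero + sum (ψ′ v))
        ≡⟨ cong₂ (λ y z → y + X + z) (diag zero) (sum-+ (λ v → ψ (suc v) zero) (λ v → sum (ψ′ v))) ⟩
      0ℤ + X + (Z + R′)
        ≡⟨ tidy X Z R′ ⟩
      X + Z + R′
        ≡⟨ cong (_+ R′) (sym (sum-+ (λ w → ψ zero (suc w)) (λ w → ψ (suc w) zero))) ⟩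
      sum φ + R′ ∎
      where
      X = sum λ w → ψ zero (suc w)
      Z = sum λ v → ψ (suc v) zero
      R′ = sum λ v → sum (ψ′ v)
      tidy : ∀ x z r → 0ℤ + x + (z + r) ≡ x + z + r
      tidy = solve-∀

first : ∀ {n} → ℕ → (Fin n → Bool) → Fin n → Bool
first zero f i = false
first (suc k) f zero = f zero
first (suc k) f (suc i) = if f zero then first k (f ∘ suc) i else first (suc k) (f ∘ suc) i

first⇒ : ∀ {n} k (f : Fin n → Bool) i → first k f i ≡ true → f i ≡ true
first⇒ (suc k) f zero h = h
first⇒ (suc k) f (suc i) h with f zero
... | true = first⇒ k (f ∘ suc) i h
... | false = first⇒ (suc k) (f ∘ suc) i h

size-first : ∀ {n} k (f : Fin n → Bool) → + k ≤ size f → size (first k f) ≡ + k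
size-first {n} zero f _ = sum-zero {n} λ _ → refl
size-first {zero} (suc k) f (+≤+ ())
size-first {suc n} (suc k) f k<f with f zero
... | true = cong (_+_ 1ℤ) (size-first k (f ∘ suc) (by-diff _ (eq (+ k) (size (f ∘ suc))) (diff k<f)))
  where
  eq : ∀ k s → s - k ≡ 1ℤ + s - (1ℤ + k)
  eq = solve-∀
... | false = trans (+-identityˡ _) (size-first (suc k) (f ∘ suc) (≤-trans k<f (≤-reflexive (+-identityˡ (size (f ∘ suc))))))

size-at-most-one : ∀ {n} (f : Fin n → Bool) → (∀ i j → f i ≡ true → f j ≡ true → i ≡ j) → size f ≤ 1ℤ
size-at-most-one {zero} f _ = 0≤+ℕ
size-at-most-one {suc n} f unique with f zero in f₀
... | false = ≤-trans (≤-reflexive (+-identityˡ (size (f ∘ suc))))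
      (size-at-most-one (f ∘ suc) λ i j fi fj → suc-injective (unique (suc i) (suc j) fi fj))
  where open import Data.Fin.Properties using (suc-injective)
... | true = ≤-reflexive (cong (_+_ 1ℤ) (sum-zero λ i → absent i))
  where
  absent : ∀ i → ι (f (suc i)) ≡ 0ℤ
  absent i with f (suc i) in fi
  ... | false = refl
  ... | true with unique zero (suc i) f₀ fi
  ... | ()

sum₃-swap : ∀ {k m n} (f : Fin k → Fin m → Fin n → ℤ) →
  sum (λ i → sum λ v → sum λ u → f i v u) ≡ sum λ v → sum λ u → sum λ i → f i v u
sum₃-swap f = trans (∑-comm λ i v → sum λ u → f i v u) (sum-cong-≗ λ v → ∑-comm λ i u → f i v u)

-- A triangle v w u with w in B v and B u is kept when w is the only vertex of its colour in both B v and B u; then v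
-- and u lie in a common class of the colour of w. A greedy colouring with 4 k colours keeps half of the triangles.
module Heavy {n} (G : Graph n) (B : Fin n → Fin n → Bool) (inside : ∀ v u → B v u ≡ true → adj G v u ≡ true)
  (k K t : ℕ) (0<k : 0ℤ < + k) (t≡ : + t ≡ + 4 * + k) (out-degree : ∀ v → size (B v) ≤ + k) where

  common : Fin n → Fin n → ℤ
  common v w = size λ u → adj G v u ∧ B u w

  light : Fin n → Fin n → Bool
  light v w = does (common v w ≤? + K)

  lightB heavyB : Fin n → Fin n → Bool
  lightB v w = B v w ∧ light v w
  heavyB v w = B v w ∧ not (light v w)

  -- Taking exactly K of the more than K candidates gives every heavy pair the same weight, see
  -- `triangles≡`, and caps the out-degrees for the induction at K.
  selected triangle : Fin n → Fin n → Fin n → Bool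
  selected v w = first K λ u → adj G v u ∧ B u w
  triangle v w u = heavyB v w ∧ selected v w u

  triangle⇒Bvw : ∀ v w u → triangle v w u ≡ true → B v w ≡ true
  triangle⇒Bvw v w u h = proj₁ (∧-true (proj₁ (∧-true {heavyB v w} h)))

  triangle⇒adj : ∀ v w u → triangle v w u ≡ true → adj G v u ≡ true
  triangle⇒adj v w u h = proj₁ (∧-true (first⇒ K (λ u → adj G v u ∧ B u w) u (proj₂ (∧-true {heavyB v w} h))))

  triangle⇒Buw : ∀ v w u → triangle v w u ≡ true → B u w ≡ true
  triangle⇒Buw v w u h = proj₂ (∧-true {adj G v u} (first⇒ K (λ u → adj G v u ∧ B u w) u (proj₂ (∧-true {heavyB v w} h))))

  size-selected : ∀ v w → heavyB v w ≡ true → size (selected v w) ≡ + K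
  size-selected v w heavy = size-first K (λ u → adj G v u ∧ B u w) (common≥ (proj₂ (∧-true {B v w} heavy)))
    where
    common≥ : not (light v w) ≡ true → + K ≤ common v w
    common≥ _ with common v w ≤? + K
    common≥ _ | no gt = <⇒≤ (≰⇒> gt)

  size-triangle : ∀ v w → size (triangle v w) ≡ ι (heavyB v w) * + K
  size-triangle v w with heavyB v w in heavy
  ... | true = trans (size-selected v w heavy) (sym (*-identityˡ (+ K)))
  ... | false = sum-zero {n} λ _ → refl

  triangles : ℤ
  triangles = sum λ w → sum λ v → size (triangle v w)

  triangles≡ : triangles ≡ + K * sum (λ v → size (heavyB v))
  triangles≡ = trans (∑-comm λ w v → size (triangle v w)) (trans (sum₂-cong λ v w → trans (size-triangle v w) (*-comm (ι (heavyB v w)) (+ K)))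
    (sum₂-*ˡ (+ K) (λ v w → ι (heavyB v w))))

  split : sum (λ v → size (B v)) ≡ sum (λ v → size (lightB v)) + sum (λ v → size (heavyB v))
  split = trans (sum₂-cong λ v w → parts (B v w) (light v w)) (sum₂-+ (λ v w → ι (lightB v w)) (λ v w → ι (heavyB v w)))
    where
    parts : ∀ b l → ι b ≡ ι (b ∧ l) + ι (b ∧ not l)
    parts true true = refl
    parts true false = refl
    parts false _ = refl

  -- For fixed u and w in `lightB u`, the vertices v that count are among those in `common u w`, at
  -- most K. This is the hypothesis of `Respond.respond`.
  light-conflict : sum (λ u → sum λ v → ι (adj G u v) * sum λ w → ι (lightB u w) * ι (lightB v w)) ≤
    + K * sum (λ v → size (lightB v))
  light-conflict = ≤-trans (sum-mono row) (≤-reflexive (sum-*ˡ (+ K) (λ v → size (lightB v))))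
    where
    swap : ∀ a b c → a * (b * c) ≡ b * (a * c)
    swap = solve-∀
    bounded : ∀ u w → sum (λ v → ι (lightB u w) * (ι (adj G u v) * ι (lightB v w))) ≤ + K * ι (lightB u w)
    bounded u w = ≤-trans (≤-reflexive (sum-*ˡ (ι (lightB u w)) (λ v → ι (adj G u v) * ι (lightB v w))))
      (≤-trans (*-monoˡ (0≤ι (lightB u w)) (sum-mono λ v → ≤-trans (≤-reflexive (sym (ι-∧ (adj G u v) (lightB v w))))
          (ι-mono λ h → ∧-intro (proj₁ (∧-true h)) (proj₁ (∧-true {B v w} (proj₂ (∧-true {adj G u v} h)))))))
        (cap (B u w) (common u w)))
      where
      cap : ∀ b x → ι (b ∧ does (x ≤? + K)) * x ≤ + K * ι (b ∧ does (x ≤? + K))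
      cap false x = ≤-reflexive (sym (*-zeroʳ (+ K)))
      cap true x with x ≤? + K
      ... | yes x≤K = ≤-trans (≤-reflexive (*-identityˡ x)) (≤-trans x≤K (≤-reflexive (sym (*-identityʳ (+ K)))))
      ... | no _ = ≤-reflexive (sym (*-zeroʳ (+ K)))
    row : ∀ u → sum (λ v → ι (adj G u v) * sum λ w → ι (lightB u w) * ι (lightB v w)) ≤ + K * size (lightB u)
    row u = ≤-trans (≤-reflexive (trans (sum-cong-≗ λ v → trans (sym (sum-*ˡ (ι (adj G u v)) (λ w → ι (lightB u w) * ι (lightB v w))))
        (sum-cong-≗ λ w → swap (ι (adj G u v)) (ι (lightB u w)) (ι (lightB v w))))
        (∑-comm λ v w → ι (lightB u w) * (ι (adj G u v) * ι (lightB v w)))))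
      (≤-trans (sum-mono (bounded u)) (≤-reflexive (sum-*ˡ (+ K) (λ w → ι (lightB u w)))))

  -- The price of giving w and w′ the same colour: the number of triangles at w that w′ disturbs,
  -- counted once for `B v` and once for `B u`.
  ψ₀ ψ : Fin n → Fin n → ℤ
  ψ₀ w w′ = sum λ v → sum λ u → ι (triangle v w u) * (ι (B v w′) + ι (B u w′))
  ψ w w′ = ι (not (same w w′)) * ψ₀ w w′

  ψ-diag : ∀ w → ψ w w ≡ 0ℤ
  ψ-diag w rewrite same-refl w = *-zeroˡ (ψ₀ w w)

  -- A triangle v w u can be disturbed only by elements of `B v` and `B u`, at most 2 k in all. With
  -- 4 k colours the expected disturbance is at most one half per triangle.
  ψ-total : sum (λ w → sum (ψ w)) ≤ + 2 * + k * triangles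
  ψ-total = ≤-trans (sum-mono column) (≤-reflexive (sum-*ˡ (+ 2 * + k) (λ w → sum λ v → size (triangle v w))))
    where
    0≤term : ∀ w w′ v u → 0ℤ ≤ ι (triangle v w u) * (ι (B v w′) + ι (B u w′))
    0≤term w w′ v u = 0≤* (0≤ι (triangle v w u)) (0≤+ (0≤ι (B v w′)) (0≤ι (B u w′)))
    drop : ∀ b x → 0ℤ ≤ x → ι b * x ≤ x
    drop true x _ = ≤-reflexive (*-identityˡ x)
    drop false x 0≤x = 0≤x
    double : ∀ k → k + k ≡ + 2 * k
    double = solve-∀
    column : ∀ w → sum (ψ w) ≤ + 2 * + k * sum (λ v → size (triangle v w))
    column w = ≤-trans (sum-mono λ w′ → drop (not (same w w′)) (ψ₀ w w′) (sum-nonneg λ v → sum-nonneg λ u → 0≤term w w′ v u))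
      (≤-trans (≤-reflexive (sum₃-swap λ w′ v u → ι (triangle v w u) * (ι (B v w′) + ι (B u w′))))
        (≤-trans (sum₂-mono λ v u → ≤-trans (≤-reflexive (trans (sum-*ˡ (ι (triangle v w u)) (λ w′ → ι (B v w′) + ι (B u w′)))
            (cong (ι (triangle v w u) *_) (sum-+ (λ w′ → ι (B v w′)) (λ w′ → ι (B u w′))))))
          (≤-trans (*-monoˡ (0≤ι (triangle v w u)) (≤-trans (+-mono-≤ (out-degree v) (out-degree u)) (≤-reflexive (double (+ k)))))
            (≤-reflexive (*-comm (ι (triangle v w u)) (+ 2 * + k)))))
          (≤-reflexive (sum₂-*ˡ (+ 2 * + k) (λ v u → ι (triangle v w u))))))

  0<t : 0ℤ < + t
  0<t = subst (0ℤ <_) (sym t≡) (*-monoˡ-<-pos (+ 4) 0<k)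

  module Coloured (c : Fin n → Fin t)
    (few : + t * sum (λ w → sum λ w′ → ψ w w′ * ι (same (c w) (c w′))) ≤ sum λ w → sum (ψ w)) where

    conflict : Fin n → Fin n → ℤ
    conflict v w = sum λ w′ → ι (not (same w w′)) * (ι (B v w′) * ι (same (c w) (c w′)))

    unique : Fin n → Fin n → Bool
    unique v w = does (conflict v w ≤? 0ℤ)

    -- For a fixed colour j, a vertex v can lie only in the class of the single element of `B v`
    -- coloured j. The classes of one colour are therefore disjoint, and each consists of neighbours
    -- of its w.
    class : Fin t → Fin n → Fin n → Bool
    class j w v = B v w ∧ (same (c w) j ∧ unique v w)

    kept : Fin t → Fin n → Fin n → Fin n → Bool
    kept j w v u = triangle v w u ∧ (class j w v ∧ class j w u)

    size-kept : ∀ j w v → size (kept j w v) ≤ + K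
    size-kept j w v = ≤-trans (sum-mono λ u → ι-mono λ h → proj₁ (∧-true {triangle v w u} h))
      (≤-trans (≤-reflexive (size-triangle v w)) (drop (heavyB v w)))
      where
      drop : ∀ b → ι b * + K ≤ + K
      drop true = ≤-reflexive (*-identityˡ (+ K))
      drop false = 0≤+ℕ

    0≤conflict : ∀ v w → 0ℤ ≤ conflict v w
    0≤conflict v w = sum-nonneg λ w′ → 0≤* (0≤ι (not (same w w′))) (0≤* (0≤ι (B v w′)) (0≤ι (same (c w) (c w′))))

    class-disjoint : ∀ j v → sum (λ w → ι (class j w v)) ≤ 1ℤ
    class-disjoint j v = size-at-most-one (λ w → class j w v) λ w w′ hw hw′ →
      equal w w′ (coloured w hw) (coloured w′ hw′) (proj₁ (∧-true hw′)) (proj₂ (∧-true (proj₂ (∧-true {B v w} hw))))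
      where
      coloured : ∀ w → class j w v ≡ true → c w ≡ j
      coloured w hw = dec-true (c w Fin.≟ j) (proj₁ (∧-true (proj₂ (∧-true {B v w} hw))))
      equal : ∀ w w′ → c w ≡ j → c w′ ≡ j → B v w′ ≡ true → unique v w ≡ true → w ≡ w′
      equal w w′ cw cw′ Bvw′ uniq with w Fin.≟ w′ in ww′
      ... | yes w≡w′ = w≡w′
      ... | no _ = ⊥-elim (<⇒≱ (+<+ (ℕ.s≤s ℕ.z≤n)) (≤-trans one (≤-trans
              (term≤sum (λ w′ → 0≤* (0≤ι (not (same w w′))) (0≤* (0≤ι (B v w′)) (0≤ι (same (c w) (c w′))))) w′)
              (dec-true (conflict v w ≤? 0ℤ) uniq))))
        where
        one : 1ℤ ≤ ι (not (same w w′)) * (ι (B v w′) * ι (same (c w) (c w′)))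
        one rewrite ww′ | Bvw′ | cw | cw′ | same-refl j = ≤-refl

    conflicts : sum (λ w → sum λ w′ → ψ w w′ * ι (same (c w) (c w′))) ≡
      sum λ w → sum λ v → sum λ u → ι (triangle v w u) * (conflict v w + conflict u w)
    conflicts = sum-cong-≗ column
      where
      distribute : ∀ m s t b b′ → m * (t * (b + b′)) * s ≡ t * (m * (b * s) + m * (b′ * s))
      distribute = solve-∀
      column : ∀ w → sum (λ w′ → ψ w w′ * ι (same (c w) (c w′))) ≡
        sum λ v → sum λ u → ι (triangle v w u) * (conflict v w + conflict u w)
      column w = begin
        sum (λ w′ → m w′ * ψ₀ w w′ * σ w′)
          ≡⟨ sum-cong-≗ (λ w′ → trans (cong (_* σ w′) (sym (sum₂-*ˡ (m w′) (λ v u → τ v u * (ι (B v w′) + ι (B u w′))))))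
               (trans (sym (sum-*ʳ (σ w′) (λ v → sum λ u → m w′ * (τ v u * (ι (B v w′) + ι (B u w′))))))
                 (sum-cong-≗ λ v → sym (sum-*ʳ (σ w′) (λ u → m w′ * (τ v u * (ι (B v w′) + ι (B u w′)))))))) ⟩
        sum (λ w′ → sum λ v → sum λ u → m w′ * (τ v u * (ι (B v w′) + ι (B u w′))) * σ w′)
          ≡⟨ sum₃-swap (λ w′ v u → m w′ * (τ v u * (ι (B v w′) + ι (B u w′))) * σ w′) ⟩
        sum (λ v → sum λ u → sum λ w′ → m w′ * (τ v u * (ι (B v w′) + ι (B u w′))) * σ w′)
          ≡⟨ sum₂-cong (λ v u → trans (sum-cong-≗ λ w′ → distribute (m w′) (σ w′) (τ v u) (ι (B v w′)) (ι (B u w′)))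
               (trans (sum-*ˡ (τ v u) (λ w′ → m w′ * (ι (B v w′) * σ w′) + m w′ * (ι (B u w′) * σ w′)))
                 (cong (τ v u *_) (sum-+ (λ w′ → m w′ * (ι (B v w′) * σ w′)) (λ w′ → m w′ * (ι (B u w′) * σ w′)))))) ⟩
        _ ∎
        where
        open ≡-Reasoning
        m σ : Fin n → ℤ
        m w′ = ι (not (same w w′))
        σ w′ = ι (same (c w) (c w′))
        τ : Fin n → Fin n → ℤ
        τ v u = ι (triangle v w u)

    -- A union bound: with any conflict the left side is at most 0, and without conflicts the
    -- triangle is kept for the colour of w.
    survives : ∀ w v u → ι (triangle v w u) * (1ℤ - (conflict v w + conflict u w)) ≤ sum λ j → ι (kept j w v u)
    survives w v u = case (triangle v w u) refl
      where
      unique≥ : ∀ x → 0ℤ ≤ x → 1ℤ - x ≤ ι (does (x ≤? 0ℤ))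
      unique≥ x 0≤x with x ≤? 0ℤ
      ... | yes _ = by-diff x (eq x) 0≤x
        where
        eq : ∀ x → 1ℤ - (1ℤ - x) ≡ x
        eq = solve-∀
      ... | no x≰0 = by-diff (x - 1ℤ) (eq x) (diff (i<j⇒suc[i]≤j (≰⇒> x≰0)))
        where
        eq : ∀ x → 0ℤ - (1ℤ - x) ≡ x - 1ℤ
        eq = solve-∀
      both : ∀ p q {x y} → 0ℤ ≤ x → 0ℤ ≤ y → 1ℤ - x ≤ ι p → 1ℤ - y ≤ ι q → 1ℤ - (x + y) ≤ ι (p ∧ q)
      both true q {x} {y} 0≤x _ _ hq = ≤-trans (by-diff x (eq x y) 0≤x) hq
        where
        eq : ∀ x y → 1ℤ - y - (1ℤ - (x + y)) ≡ x
        eq = solve-∀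
      both false q {x} {y} _ 0≤y hp _ = ≤-trans (by-diff y (eq x y) 0≤y) hp
        where
        eq : ∀ x y → 1ℤ - x - (1ℤ - (x + y)) ≡ y
        eq = solve-∀
      case : ∀ b → triangle v w u ≡ b → ι b * (1ℤ - (conflict v w + conflict u w)) ≤ sum λ j → ι (kept j w v u)
      case false _ = sum-nonneg λ j → 0≤ι (kept j w v u)
      case true vwu = ≤-trans (≤-reflexive (*-identityˡ (1ℤ - (conflict v w + conflict u w))))
        (≤-trans (both (unique v w) (unique u w) (0≤conflict v w) (0≤conflict u w)
            (unique≥ (conflict v w) (0≤conflict v w)) (unique≥ (conflict u w) (0≤conflict u w)))
          (≤-trans (≤-reflexive (cong ι (sym kept≡))) (term≤sum {f = λ j → ι (kept j w v u)} (λ j → 0≤ι (kept j w v u)) (c w))))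
        where
        kept≡ : kept (c w) w v u ≡ unique v w ∧ unique u w
        kept≡ rewrite vwu | triangle⇒Bvw v w u vwu | triangle⇒Buw v w u vwu | same-refl (c w) = refl

    half-survive : triangles ≤ + 2 * sum (λ j → sum λ w → sum λ v → size (kept j w v))
    half-survive = by-diff _ (eq triangles X Y) (0≤+ (0≤* {+ 2} 0≤+ℕ (diff most)) (diff 2X≤))
      where
      X = sum λ w → sum λ v → sum λ u → ι (triangle v w u) * (conflict v w + conflict u w)
      Y = sum λ j → sum λ w → sum λ v → size (kept j w v)
      eq : ∀ N X Y → + 2 * Y - N ≡ + 2 * (Y - (N + -1ℤ * X)) + (N - + 2 * X)
      eq = solve-∀
      expand : ∀ a x → a * (1ℤ - x) ≡ a + -1ℤ * (a * x)
      expand = solve-∀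
      lhs : sum (λ w → sum λ v → sum λ u → ι (triangle v w u) * (1ℤ - (conflict v w + conflict u w))) ≡ triangles + -1ℤ * X
      lhs = trans (sum-cong-≗ λ w → trans (sum₂-cong λ v u → expand (ι (triangle v w u)) (conflict v w + conflict u w))
          (trans (sum₂-+ (λ v u → ι (triangle v w u)) (λ v u → -1ℤ * (ι (triangle v w u) * (conflict v w + conflict u w))))
            (cong (_+_ (sum λ v → size (triangle v w))) (sum₂-*ˡ -1ℤ (λ v u → ι (triangle v w u) * (conflict v w + conflict u w))))))
        (trans (sum-+ (λ w → sum λ v → size (triangle v w)) (λ w → -1ℤ * sum λ v → sum λ u → ι (triangle v w u) * (conflict v w + conflict u w)))
          (cong (_+_ triangles) (sum-*ˡ -1ℤ (λ w → sum λ v → sum λ u → ι (triangle v w u) * (conflict v w + conflict u w)))))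
      rhs : sum (λ w → sum λ v → sum λ u → sum λ j → ι (kept j w v u)) ≡ Y
      rhs = trans (sum-cong-≗ λ w → sym (sum₃-swap λ j v u → ι (kept j w v u))) (∑-comm λ w j → sum λ v → size (kept j w v))
      most : triangles + -1ℤ * X ≤ Y
      most = subst₂ _≤_ lhs rhs (sum-mono λ w → sum₂-mono (survives w))
      2X≤ : + 2 * X ≤ triangles
      2X≤ = *-cancelˡ-≤ {+ 2 * + k} (*-monoˡ-<-pos (+ 2) 0<k) (≤-trans (≤-reflexive (assoc (+ k) X))
        (≤-trans (subst₂ (λ y z → y * z ≤ sum λ w → sum (ψ w)) t≡ conflicts few) ψ-total))
        where
        assoc : ∀ k x → + 2 * k * (+ 2 * x) ≡ + 4 * k * x
        assoc = solve-∀

sparse-constant : ℕ → ℕ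
sparse-constant zero = 0
sparse-constant (suc ρ) = 17 ℕ.+ 8 ℕ.* sparse-constant ρ

-- With K = s^(r-2): either v shares at most K neighbours with most of B v, and the response of v to B v is not undone by
-- adjacent responses, or many disjoint neighbourhoods contain graphs of out-degree K, and the bound for r - 1 applies.
sparse-bound : ∀ ρ {n} (G : Graph n) (B : Fin n → Fin n → Bool) s {T} → 1 ℕ.≤ s →
  (∀ v u → B v u ≡ true → adj G v u ≡ true) → (∀ v → size (B v) ≤ + (s ℕ.^ suc ρ)) →
  KFree (2 ℕ.+ ρ) G → Surplus≤ G T → sum (λ v → size (B v)) ≤ + (sparse-constant ρ ℕ.* s ℕ.^ ρ) * T
sparse-bound zero G B s {T} _ inside _ free _ = ≤-reflexive (trans (sum-zero λ v → sum-zero λ u → none v u) (sym (*-zeroˡ T)))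
  where
  none : ∀ v u → ι (B v u) ≡ 0ℤ
  none v u with B v u in vu
  ... | false = refl
  ... | true with trans (sym (K₂-free⇒nonadjacent G free v u)) (inside v u vu)
  ... | ()
sparse-bound (suc ρ) {n} G B s {T} 1≤s inside out-degree free surplus =
  ≤-trans (≤-reflexive split) (≤-trans (+-mono-≤ M-light M-heavy) (≤-reflexive total))
  where
  K k : ℕ
  K = s ℕ.^ suc ρ
  k = s ℕ.* K
  instance
    s≢0 : ℕ.NonZero s
    s≢0 = ℕ.>-nonZero 1≤s
  1≤K : 1 ℕ.≤ K
  1≤K = ℕ.m^n>0 s (suc ρ)
  0<K : 0ℤ < + K
  0<K = 0<⇒0<+ 1≤K
  0<k : 0ℤ < + k
  0<k = 0<⇒0<+ (ℕ.*-mono-≤ 1≤s 1≤K)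
  open Heavy G B inside k K (4 ℕ.* k) 0<k (pos-* 4 k) out-degree
  D : ℤ
  D = + (sparse-constant ρ ℕ.* s ℕ.^ ρ)
  k≤K² : + k ≤ + K * + K
  k≤K² = ≤-trans (+≤+ (ℕ.*-monoˡ-≤ K (ℕ.m≤m*n s (s ℕ.^ ρ) ⦃ ℕ.m^n≢0 s ρ ⦄))) (≤-reflexive (pos-* K K))
  M-light : sum (λ v → size (lightB v)) ≤ + 17 * + K * T
  M-light = Respond.respond G lightB (λ v u h → inside v u (proj₁ (∧-true h))) (+ K) (+ k) (+≤+ 1≤K) k≤K²
    (λ v → ≤-trans (sum-mono λ u → ι-mono λ h → proj₁ (∧-true {B v u} h)) (out-degree v)) {T} surplus light-conflict
  module _ (c : Fin n → Fin (4 ℕ.* k))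
    (few : + (4 ℕ.* k) * sum (λ w → sum λ w′ → ψ w w′ * ι (same (c w) (c w′))) ≤ sum λ w → sum (ψ w)) where
    open Coloured c few
    kept-total : ∀ j → sum (λ w → sum λ v → size (kept j w v)) ≤ D * T
    kept-total j = ≤-trans (sum-mono induction) (≤-trans (≤-reflexive (sum-*ˡ D S)) (*-monoˡ {D} 0≤+ℕ (proj₂ (proj₂ (proj₂ parts)))))
      where
      parts = disjoint-surplus G {T} (class j) surplus (class-disjoint j)
      S : Fin n → ℤ
      S = proj₁ parts
      induction : ∀ w → sum (λ v → size (kept j w v)) ≤ D * S w
      induction w = sparse-bound ρ (restrict G (class j w)) (kept j w) s {S w} 1≤s
        (λ v u h → ∧-intro (triangle⇒adj v w u (proj₁ (∧-true h))) (proj₂ (∧-true {triangle v w u} h)))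
        (size-kept j w) (KFree-neighbourhood G (class j w) w (λ v h → inside v w (proj₁ (∧-true h))) free)
        (proj₁ (proj₂ (proj₂ parts)) w)
    triangles≤ : triangles ≤ + 2 * (+ 4 * + k * (D * T))
    triangles≤ = ≤-trans half-survive (*-monoˡ {+ 2} 0≤+ℕ (≤-trans (sum-mono kept-total)
      (≤-reflexive (trans (sum-const (4 ℕ.* k) (D * T)) (cong (_* (D * T)) (pos-* 4 k))))))
  -- Each of the 4 k colours contributes at most D T by induction, and half of the triangles are
  -- kept, so K times the heavy pairs is at most 8 k D T. Division by K leaves k / K = s, the
  -- additional power of s.
  M-heavy : sum (λ v → size (heavyB v)) ≤ + 8 * (+ s * D) * T
  M-heavy = *-cancelˡ-≤ 0<K (≤-trans (≤-reflexive (sym triangles≡)) (≤-trans (triangles≤ (proj₁ coloured) (proj₂ coloured))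
    (≤-reflexive (trans (cong (λ z → + 2 * (+ 4 * z * (D * T))) (pos-* s K)) (regroup (+ s) (+ K) D T)))))
    where
    coloured = colouring (4 ℕ.* k) ψ 0<t ψ-diag
    regroup : ∀ s K D T → + 2 * (+ 4 * (s * K) * (D * T)) ≡ K * (+ 8 * (s * D) * T)
    regroup = solve-∀
  total : + 17 * + K * T + + 8 * (+ s * D) * T ≡ + ((17 ℕ.+ 8 ℕ.* sparse-constant ρ) ℕ.* K) * T
  total = trans (sym (*-distribʳ-+ T (+ 17 * + K) (+ 8 * (+ s * D)))) (cong (_* T) (trans
    (cong₂ _+_ (sym (pos-* 17 K)) (trans (cong (+ 8 *_) (sym (pos-* s (sparse-constant ρ ℕ.* s ℕ.^ ρ))))
      (sym (pos-* 8 (s ℕ.* (sparse-constant ρ ℕ.* s ℕ.^ ρ))))))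
    (cong +_ (collect 17 8 s (sparse-constant ρ) (s ℕ.^ ρ)))))
    where
    collect : ∀ a b s C p → a ℕ.* (s ℕ.* p) ℕ.+ b ℕ.* (s ℕ.* (C ℕ.* p)) ≡ (a ℕ.+ b ℕ.* C) ℕ.* (s ℕ.* p)
    collect = ℕSolver.solve-∀

-- Counting edges and cuts

countT-++ : ∀ xs ys → countT (xs ++ ys) ≡ countT xs ℕ.+ countT ys
countT-++ [] ys = refl
countT-++ (true ∷ xs) ys = cong suc (countT-++ xs ys)
countT-++ (false ∷ xs) ys = countT-++ xs ys

countT-tabulate : ∀ {n} (f : Fin n → Bool) → + countT (tabulate f) ≡ sum λ i → ι (f i)
countT-tabulate {zero} f = refl
countT-tabulate {suc n} f with f zero
... | true = cong (_+_ 1ℤ) (countT-tabulate (f ∘ suc))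
... | false = trans (countT-tabulate (f ∘ suc)) (sym (+-identityˡ (sum λ i → ι (f (suc i)))))

countT-pairs : ∀ {n} (p : Fin n × Fin n → Bool) →
  + countT (map p (pairs n)) ≡ sum λ i → sum λ j → ι (p (i , j))
countT-pairs {n} p = rows (λ i → i)
  where
  -- The outer index runs through g, so that the outer list can shrink while the inner one remains
  -- `allFin n`.
  rows : ∀ {m} (g : Fin m → Fin n) →
    + countT (map p (concatMap (λ i → map (i ,_) (allFin n)) (tabulate g))) ≡ sum λ i → sum λ j → ι (p (g i , j))
  rows {zero} g = refl
  rows {suc m} g = begin
    + countT (map p (row ++ rest))
      ≡⟨ cong (λ xs → + countT xs) (map-++ p row rest) ⟩
    + countT (map p row ++ map p rest)
      ≡⟨ cong +_ (countT-++ (map p row) (map p rest)) ⟩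
    + countT (map p row) + + countT (map p rest)
      ≡⟨ cong₂ _+_ (trans (cong (λ xs → + countT xs) (trans (cong (map p) (map-tabulate (λ j → j) (g zero ,_))) (map-tabulate (g zero ,_) p)))
           (countT-tabulate (λ j → p (g zero , j)))) (rows (g ∘ suc)) ⟩
    _ ∎
    where
    open ≡-Reasoning
    row = map (g zero ,_) (allFin n)
    rest = concatMap (λ i → map (i ,_) (allFin n)) (tabulate (g ∘ suc))

ordered : ∀ {n} → Fin n → Fin n → Bool
ordered i j = toℕ i <ᵇ toℕ j

trichotomy : ∀ m n → m ≢ n → ι (m <ᵇ n) + ι (n <ᵇ m) ≡ 1ℤ
trichotomy zero zero m≢n = ⊥-elim (m≢n refl)
trichotomy zero (suc n) _ = refl
trichotomy (suc m) zero _ = refl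
trichotomy (suc m) (suc n) m≢n = trichotomy m n (m≢n ∘ cong suc)

quad-ordered : ∀ {n} (G : Graph n) x →
  quad G x ≡ + 2 * sum λ i → sum λ j → ι (ordered i j ∧ adj G i j) * (x i * x j)
quad-ordered {n} G x = begin
  quad G x
    ≡⟨ sum₂-cong (λ i j → trans (cong (_* (x i * x j)) (orient i j)) (trans (*-distribʳ-+ (x i * x j) (a i j) (a j i))
         (cong (λ z → a i j * (x i * x j) + a j i * z) (*-comm (x i) (x j))))) ⟩
  sum (λ i → sum λ j → a i j * (x i * x j) + a j i * (x j * x i))
    ≡⟨ trans (sum₂-+ (λ i j → a i j * (x i * x j)) (λ i j → a j i * (x j * x i)))
         (cong (_+_ half) (∑-comm λ i j → a j i * (x j * x i))) ⟩
  half + half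
    ≡⟨ double half ⟩
  + 2 * half ∎
  where
  open ≡-Reasoning
  a : Fin n → Fin n → ℤ
  a i j = ι (ordered i j ∧ adj G i j)
  half = sum λ i → sum λ j → a i j * (x i * x j)
  double : ∀ z → z + z ≡ + 2 * z
  double = solve-∀
  orient : ∀ i j → ι (adj G i j) ≡ a i j + a j i
  orient i j rewrite Graph.sym G j i with adj G i j in ij
  ... | false = sym (cong₂ _+_ (none (ordered i j)) (none (ordered j i)))
    where
    none : ∀ b → ι (b ∧ false) ≡ 0ℤ
    none true = refl
    none false = refl
  ... | true = sym (trans (cong₂ _+_ (all (ordered i j)) (all (ordered j i))) (trichotomy (toℕ i) (toℕ j) λ i≡j → distinct (toℕ-injective i≡j)))
    where
    all : ∀ b → ι (b ∧ true) ≡ ι b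
    all true = refl
    all false = refl
    distinct : i ≢ j
    distinct refl with trans (sym ij) (irrefl G i)
    ... | ()

edges₂≡ : ∀ {n} (G : Graph n) → edges₂ G ≡ + 2 * + e G
edges₂≡ {n} G = begin
  edges₂ G
    ≡⟨ sum₂-cong (λ i j → sym (*-identityʳ (ι (adj G i j)))) ⟩
  quad G (λ _ → 1ℤ)
    ≡⟨ quad-ordered G (λ _ → 1ℤ) ⟩
  + 2 * (sum λ i → sum λ j → ι (ordered i j ∧ adj G i j) * 1ℤ)
    ≡⟨ cong (+ 2 *_) (trans (sum₂-cong λ i j → *-identityʳ (ι (ordered i j ∧ adj G i j)))
         (sym (countT-pairs λ { (i , j) → ordered i j ∧ adj G i j }))) ⟩
  + 2 * + countT (map (λ { (i , j) → ordered i j ∧ adj G i j }) (pairs n))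
    ≡⟨⟩
  _ ∎
  where open ≡-Reasoning

quad-signs : ∀ {n} (G : Graph n) s → quad G (signs s) ≡ + 2 * (+ e G - + 2 * + cut G s)
quad-signs {n} G s = trans (quad-ordered G (signs s)) (cong (+ 2 *_) (begin
  sum (λ i → sum λ j → ι (ordered i j ∧ adj G i j) * (signs s i * signs s j))
    ≡⟨ sum₂-cong (λ i j → term (ordered i j) (adj G i j) (lookup s i) (lookup s j)) ⟩
  sum (λ i → sum λ j → edge i j + - (+ 2) * crossing i j)
    ≡⟨ trans (sum₂-+ edge (λ i j → - (+ 2) * crossing i j)) (cong₂ _+_ (sym (countT-pairs λ { (i , j) → ordered i j ∧ adj G i j }))
         (trans (sum₂-*ˡ (- (+ 2)) crossing) (cong (- (+ 2) *_)
           (sym (countT-pairs λ { (i , j) → ordered i j ∧ adj G i j ∧ (lookup s i xor lookup s j) }))))) ⟩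
  + e G + - (+ 2) * + cut G s
    ≡⟨ tidy (+ e G) (+ cut G s) ⟩
  + e G - + 2 * + cut G s ∎))
  where
  open ≡-Reasoning
  edge crossing : Fin n → Fin n → ℤ
  edge i j = ι (ordered i j ∧ adj G i j)
  crossing i j = ι (ordered i j ∧ adj G i j ∧ (lookup s i xor lookup s j))
  tidy : ∀ a b → a + - (+ 2) * b ≡ a - + 2 * b
  tidy = solve-∀
  term : ∀ o a σ τ → ι (o ∧ a) * (sgn σ * sgn τ) ≡ ι (o ∧ a) + - (+ 2) * ι (o ∧ a ∧ (σ xor τ))
  term false a σ τ = trans (*-zeroˡ (sgn σ * sgn τ)) refl
  term true false σ τ = trans (*-zeroˡ (sgn σ * sgn τ)) refl
  term true true true true = refl
  term true true true false = refl
  term true true false true = refl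
  term true true false false = refl

allVecs-complete : ∀ {n} (s : Vec Bool n) → s ∈ allVecs n
allVecs-complete [] = here refl
allVecs-complete (σ ∷ s) = ∈-concatMap⁺ (λ v → (true ∷ v) ∷ (false ∷ v) ∷ []) (extend σ (allVecs-complete s))
  where
  extend : ∀ σ {xs} → s ∈ xs → Any (λ v → (σ ∷ s) ∈ ((true ∷ v) ∷ (false ∷ v) ∷ [])) xs
  extend true (here refl) = here (here refl)
  extend false (here refl) = here (there (here refl))
  extend σ (there s∈) = there (extend σ s∈)

≤foldr-⊔ : ∀ {A : Set} (f : A → ℕ) {x xs} → x ∈ xs → f x ℕ.≤ foldr _⊔_ 0 (map f xs)
≤foldr-⊔ f {x} {_ ∷ xs} (here refl) = ℕ.m≤m⊔n (f x) _
≤foldr-⊔ f {x} {y ∷ xs} (there x∈) = ℕ.≤-trans (≤foldr-⊔ f x∈) (ℕ.m≤n⊔m (f y) _)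

cut≤mc : ∀ {n} (G : Graph n) s → cut G s ℕ.≤ mc G
cut≤mc G s = ≤foldr-⊔ (cut G) (allVecs-complete s)

-- This is 4 (mc - cut) ≥ 0 rewritten by `quad-signs`; the truncated difference is never below the
-- integer one.
surplus≤ : ∀ {n} (G : Graph n) → Surplus≤ G (+ 2 * + (2 ℕ.* mc G ℕ.∸ e G))
surplus≤ G s = ≤-trans (≤-trans (0≤* {+ 4} 0≤+ℕ (diff (+≤+ (cut≤mc G s)))) (≤-reflexive (eq (+ mc G) (+ e G) (+ cut G s))))
  (+-mono-≤ (*-monoˡ {+ 2} 0≤+ℕ monus) (≤-reflexive (sym (quad-signs G s))))
  where
  eq : ∀ μ m c → + 4 * (μ - c) ≡ + 2 * (+ 2 * μ - m) + + 2 * (m - + 2 * c)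
  eq = solve-∀
  monus : + 2 * + mc G - + e G ≤ + (2 ℕ.* mc G ℕ.∸ e G)
  monus = by-diff _ (eq′ (+ (2 ℕ.* mc G ℕ.∸ e G)) (+ e G) (+ 2 * + mc G))
    (diff (subst (_≤ + (e G) + + (2 ℕ.* mc G ℕ.∸ e G)) (pos-* 2 (mc G)) (+≤+ (ℕ.m≤n+m∸n (2 ℕ.* mc G) (e G)))))
    where
    eq′ : ∀ d m μ → d - (μ - m) ≡ m + d - μ
    eq′ = solve-∀

-- Choice of the scale and the final exponent

integer-root : ∀ p m → ∃ λ s → s ℕ.^ suc p ℕ.≤ m × m ℕ.< suc s ℕ.^ suc p
integer-root p zero = 0 , ℕ.z≤n , ℕ.m^n>0 1 (suc p)
integer-root p (suc m) with integer-root p m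
... | s , s^p≤m , m<S^p with suc s ℕ.^ suc p ℕ.≤? suc m
...   | yes S^p≤ = suc s , S^p≤ , ℕ.≤-<-trans m<S^p (ℕ.^-monoˡ-< (suc p) (ℕ.n<1+n (suc s)))
...   | no S^p≰ = s , ℕ.m≤n⇒m≤1+n s^p≤m , ℕ.≰⇒> S^p≰

constant : ℕ → ℕ → ℕ
constant Q ρ = 8 ℕ.* sparse-constant ρ ℕ.+ 4 ℕ.* (dense-constant ρ ℕ.* Q ℕ.^ ρ)

-- Vertices of degree at most D = s^(r-1) are handled by sparse-bound; the others are few, so they span a dense graph.
edges₂-bound : ∀ ρ {n} (G : Graph n) Q s {T} → 1 ℕ.≤ s → 1 ℕ.≤ Q →
  + 4 * edges₂ G ≤ + (Q ℕ.* s) * (+ (s ℕ.^ suc ρ) * + (s ℕ.^ suc ρ)) →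
  KFree (2 ℕ.+ ρ) G → Surplus≤ G T → edges₂ G ≤ + (constant Q ρ ℕ.* s ℕ.^ ρ) * T
edges₂-bound ρ {n} G Q s {T} 1≤s 1≤Q few free surplus =
  ≤-trans E≤ (≤-reflexive (cong (_* T) (sym constant≡)))
  where
  instance
    s≢0 : ℕ.NonZero s
    s≢0 = ℕ.>-nonZero 1≤s
  q : ℕ
  q = Q ℕ.* s
  1≤q : 1 ℕ.≤ q
  1≤q = ℕ.*-mono-≤ 1≤Q 1≤s
  D E : ℤ
  D = + (s ℕ.^ suc ρ)
  E = edges₂ G
  0<D : 0ℤ < D
  0<D = 0<⇒0<+ (ℕ.m^n>0 s (suc ρ))
  0≤T : 0ℤ ≤ T
  0≤T = surplus-nonneg G {T} surplus
  0≤E : 0ℤ ≤ E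
  0≤E = sum-nonneg (0≤degree G)
  low high : Fin n → Bool
  low v = does (degree G v ≤? D)
  high v = not (low v)
  B : Fin n → Fin n → Bool
  B v u = low v ∧ adj G v u
  M ν E-high : ℤ
  M = sum λ v → size (B v)
  ν = size high
  E-high = edges₂ (restrict G high)
  0≤ν : 0ℤ ≤ ν
  0≤ν = sum-nonneg λ v → 0≤ι (high v)
  M≤ : M ≤ + (sparse-constant ρ ℕ.* s ℕ.^ ρ) * T
  M≤ = sparse-bound ρ G B s {T} 1≤s (λ v u h → proj₂ (∧-true {low v} h)) out-degree free surplus
    where
    out-degree : ∀ v → size (B v) ≤ D
    out-degree v with degree G v ≤? D
    ... | yes d≤D = d≤D
    ... | no _ = ≤-trans (≤-reflexive (sum-zero {n} λ _ → refl)) 0≤+ℕ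
  parts = disjoint-surplus {t = 1} G {T} (λ _ → high) surplus λ v → ≤-trans (≤-reflexive (+-identityʳ (ι (high v)))) (ι≤1 (high v))
  E-high≤ : + q * E-high ≤ ν * ν + + (dense-constant ρ ℕ.* q ℕ.^ suc ρ) * T
  E-high≤ = ≤-trans (dense-bound ρ (restrict G high) high (λ u v h → proj₁ (∧-true (proj₂ (∧-true {adj G u v} h)))) q {S}
      1≤q (KFree-restrict G high free) (proj₁ (proj₂ (proj₂ parts)) zero))
    (+-monoʳ-≤ (ν * ν) (*-monoˡ {+ (dense-constant ρ ℕ.* q ℕ.^ suc ρ)} 0≤+ℕ
      (≤-trans (≤-reflexive (sym (+-identityʳ S))) (proj₂ (proj₂ (proj₂ parts))))))
    where
    S = proj₁ parts zero
  cover : E ≤ M + M + E-high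
  cover = ≤-trans (sum₂-mono λ u v → step u v) (≤-reflexive (trans
    (sum₂-+ (λ u v → ι (B u v) + ι (B v u)) (λ u v → ι (adj G u v ∧ (high u ∧ high v))))
    (cong (_+ E-high) (trans (sum₂-+ (λ u v → ι (B u v)) (λ u v → ι (B v u))) (cong (_+_ M) (∑-comm λ u v → ι (B v u)))))))
    where
    cases : ∀ a l l′ → ι a ≤ ι (l ∧ a) + ι (l′ ∧ a) + ι (a ∧ (not l ∧ not l′))
    cases false true true = ≤-refl
    cases false true false = ≤-refl
    cases false false true = ≤-refl
    cases false false false = ≤-refl
    cases true true true = +≤+ (ℕ.s≤s ℕ.z≤n)
    cases true true false = ≤-refl
    cases true false true = ≤-refl
    cases true false false = ≤-refl
    step : ∀ u v → ι (adj G u v) ≤ ι (B u v) + ι (B v u) + ι (adj G u v ∧ (high u ∧ high v))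
    step u v rewrite Graph.sym G v u = cases (adj G u v) (low u) (low v)
  νD≤E : ν * D ≤ E
  νD≤E = ≤-trans (≤-reflexive (sym (sum-*ʳ D (λ v → ι (high v))))) (sum-mono step)
    where
    step : ∀ v → ι (high v) * D ≤ degree G v
    step v with degree G v ≤? D
    ... | yes _ = 0≤degree G v
    ... | no d≰D = ≤-trans (≤-reflexive (*-identityˡ D)) (<⇒≤ (≰⇒> d≰D))
  -- Counting degrees gives ν ≤ E / D, and `few` says 4 E ≤ q D².
  4ν²≤qE : + 4 * (ν * ν) ≤ + q * E
  4ν²≤qE = *-cancelˡ-≤ 0<D (*-cancelˡ-≤ 0<D (by-diff _ (eq D ν E (+ q))
    (0≤+ (0≤* 0≤E (diff few)) (0≤* {+ 4} 0≤+ℕ (0≤+ (0≤* 0≤E (diff νD≤E)) (0≤* (0≤* 0≤ν (<⇒≤ 0<D)) (diff νD≤E)))))))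
    where
    eq : ∀ D ν E q → D * (D * (q * E)) - D * (D * (+ 4 * (ν * ν))) ≡
      E * (q * (D * D) - + 4 * E) + + 4 * (E * (E - ν * D) + ν * D * (E - ν * D))
    eq = solve-∀
  cs cd : ℤ
  cs = + (sparse-constant ρ ℕ.* s ℕ.^ ρ)
  cd = + (dense-constant ρ ℕ.* q ℕ.^ ρ)
  dense≡ : + (dense-constant ρ ℕ.* q ℕ.^ suc ρ) ≡ + q * cd
  dense≡ = trans (cong +_ (swap (dense-constant ρ) q (q ℕ.^ ρ))) (pos-* q (dense-constant ρ ℕ.* q ℕ.^ ρ))
    where
    swap : ∀ c q p → c ℕ.* (q ℕ.* p) ≡ q ℕ.* (c ℕ.* p)
    swap = ℕSolver.solve-∀
  -- The term ν ν costs only q E / 4 in `E-high≤`; after multiplying `cover` by 4 q it is absorbed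
  -- by the left side.
  E≤ : E ≤ (+ 8 * cs + + 4 * cd) * T
  E≤ = *-cancelˡ-≤ (0<⇒0<+ 1≤q) (by-diff _ (eq (+ q) E M E-high ν T cs cd)
    (0≤+ (0≤+ (0≤* (0≤* {+ 4} {+ q} 0≤+ℕ 0≤+ℕ) (diff cover))
        (0≤* {+ 4} 0≤+ℕ (diff (subst (λ z → + q * E-high ≤ ν * ν + z * T) dense≡ E-high≤))))
      (0≤+ (0≤+ (diff 4ν²≤qE) (0≤* (0≤* {+ 8} {+ q} 0≤+ℕ 0≤+ℕ) (diff M≤))) (0≤* (0≤* {+ 2} {+ q} 0≤+ℕ 0≤+ℕ) 0≤E))))
    where
    eq : ∀ q E M H ν T a b → q * ((+ 8 * a + + 4 * b) * T) - q * E ≡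
      (+ 4 * q * (M + M + H - E) + + 4 * (ν * ν + q * b * T - q * H)) +
      ((q * E - + 4 * (ν * ν)) + + 8 * q * (a * T - M) + + 2 * q * E)
    eq = solve-∀
  constant≡ : + (constant Q ρ ℕ.* s ℕ.^ ρ) ≡ + 8 * cs + + 4 * cd
  constant≡ = trans (cong +_ (trans (expand 8 4 (sparse-constant ρ) (dense-constant ρ) (Q ℕ.^ ρ) (s ℕ.^ ρ))
      (cong (λ z → 8 ℕ.* (sparse-constant ρ ℕ.* s ℕ.^ ρ) ℕ.+ 4 ℕ.* (dense-constant ρ ℕ.* z)) (sym (^-distribʳ-* ρ Q s)))))
    (cong₂ _+_ (pos-* 8 (sparse-constant ρ ℕ.* s ℕ.^ ρ)) (pos-* 4 (dense-constant ρ ℕ.* q ℕ.^ ρ)))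
    where
    expand : ∀ a b c d Q s → (a ℕ.* c ℕ.+ b ℕ.* (d ℕ.* Q)) ℕ.* s ≡ a ℕ.* (c ℕ.* s) ℕ.+ b ℕ.* (d ℕ.* (Q ℕ.* s))
    expand = ℕSolver.solve-∀

module _ (ρ : ℕ) where

  exponent : ℕ
  exponent = suc (suc ρ ℕ.+ suc ρ)

  -- The factor 2^exponent pays for replacing s + 1 by 2 s, and 8 is for `4 * edges₂ G`, which is 8
  -- e(G).
  scale bound : ℕ
  scale = 8 ℕ.* 2 ℕ.^ exponent
  bound = constant scale ρ

  edges-bound : ∀ {n} (G : Graph n) s → 1 ℕ.≤ s → e G ℕ.< suc s ℕ.^ exponent → KFree (2 ℕ.+ ρ) G →
    e G ℕ.≤ bound ℕ.* s ℕ.^ ρ ℕ.* (2 ℕ.* mc G ℕ.∸ e G)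
  edges-bound G s 1≤s e<S free = drop‿+≤+ (*-cancelˡ-≤ {+ 2} (+<+ (ℕ.s≤s ℕ.z≤n)) (≤-trans (≤-reflexive (sym (edges₂≡ G)))
    (≤-trans (edges₂-bound ρ G scale s 1≤s (ℕ.*-mono-≤ {1} {8} (ℕ.s≤s ℕ.z≤n) (ℕ.m^n>0 2 exponent)) few free (surplus≤ G))
      (≤-reflexive (trans (swap (+ (bound ℕ.* s ℕ.^ ρ)) (+ (2 ℕ.* mc G ℕ.∸ e G)))
        (cong (+ 2 *_) (sym (pos-* (bound ℕ.* s ℕ.^ ρ) (2 ℕ.* mc G ℕ.∸ e G)))))))))
    where
    open ℕ.≤-Reasoning
    swap : ∀ b t → b * (+ 2 * t) ≡ + 2 * (b * t)
    swap = solve-∀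
    D : ℕ
    D = s ℕ.^ suc ρ
    8e≤ : 8 ℕ.* e G ℕ.≤ scale ℕ.* s ℕ.* (D ℕ.* D)
    8e≤ = begin
      8 ℕ.* e G
        ≤⟨ ℕ.*-monoʳ-≤ 8 (ℕ.≤-trans (ℕ.<⇒≤ e<S) (ℕ.^-monoˡ-≤ exponent suc≤)) ⟩
      8 ℕ.* (2 ℕ.* s) ℕ.^ exponent
        ≡⟨ cong (8 ℕ.*_) (^-distribʳ-* exponent 2 s) ⟩
      8 ℕ.* (2 ℕ.^ exponent ℕ.* (s ℕ.* s ℕ.^ (suc ρ ℕ.+ suc ρ)))
        ≡⟨ cong (λ z → 8 ℕ.* (2 ℕ.^ exponent ℕ.* (s ℕ.* z))) (ℕ.^-distribˡ-+-* s (suc ρ) (suc ρ)) ⟩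
      8 ℕ.* (2 ℕ.^ exponent ℕ.* (s ℕ.* (D ℕ.* D)))
        ≡⟨ assoc 8 (2 ℕ.^ exponent) s (D ℕ.* D) ⟩
      scale ℕ.* s ℕ.* (D ℕ.* D) ∎
      where
      assoc : ∀ a b s d → a ℕ.* (b ℕ.* (s ℕ.* d)) ≡ a ℕ.* b ℕ.* s ℕ.* d
      assoc = ℕSolver.solve-∀
      suc≤ : suc s ℕ.≤ 2 ℕ.* s
      suc≤ = subst (suc s ℕ.≤_) (sym (cong (s ℕ.+_) (ℕ.+-identityʳ s))) (ℕ.+-monoˡ-≤ s 1≤s)
    few : + 4 * edges₂ G ≤ + (scale ℕ.* s) * (+ D * + D)
    few = subst₂ _≤_ (trans (pos-* 8 (e G)) (trans (four (+ e G)) (cong (+ 4 *_) (sym (edges₂≡ G)))))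
      (trans (pos-* (scale ℕ.* s) (D ℕ.* D)) (cong (+ (scale ℕ.* s) *_) (pos-* D D))) (+≤+ 8e≤)
      where
      four : ∀ m → + 8 * m ≡ + 4 * (+ 2 * m)
      four = solve-∀

  -- Raised to the power 2 ρ + 3, the factor s^ρ turns into at most m^ρ. Cancelling it leaves m to
  -- the power ρ + 3, that is r + 1.
  power-bound : ∀ A m s τ → 1 ℕ.≤ m → s ℕ.^ exponent ℕ.≤ m → m ℕ.≤ A ℕ.* s ℕ.^ ρ ℕ.* τ →
    m ℕ.^ (3 ℕ.+ ρ) ℕ.≤ A ℕ.^ exponent ℕ.* τ ℕ.^ exponent
  power-bound A m s τ 1≤m s^p≤m m≤ = ℕ.*-cancelˡ-≤ (m ℕ.^ ρ) ⦃ ℕ.m^n≢0 m ρ ⦃ ℕ.>-nonZero 1≤m ⦄ ⦄ (begin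
    m ℕ.^ ρ ℕ.* m ℕ.^ (3 ℕ.+ ρ)
      ≡⟨ sym (ℕ.^-distribˡ-+-* m ρ (3 ℕ.+ ρ)) ⟩
    m ℕ.^ (ρ ℕ.+ (3 ℕ.+ ρ))
      ≡⟨ cong (m ℕ.^_) (exponents ρ) ⟩
    m ℕ.^ exponent
      ≤⟨ ℕ.^-monoˡ-≤ exponent m≤ ⟩
    (A ℕ.* s ℕ.^ ρ ℕ.* τ) ℕ.^ exponent
      ≡⟨ trans (^-distribʳ-* exponent (A ℕ.* s ℕ.^ ρ) τ) (cong (ℕ._* τ ℕ.^ exponent) (^-distribʳ-* exponent A (s ℕ.^ ρ))) ⟩
    A ℕ.^ exponent ℕ.* (s ℕ.^ ρ) ℕ.^ exponent ℕ.* τ ℕ.^ exponent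
      ≡⟨ cong (λ z → A ℕ.^ exponent ℕ.* z ℕ.* τ ℕ.^ exponent) (trans (ℕ.^-*-assoc s ρ exponent)
           (trans (cong (s ℕ.^_) (ℕ.*-comm ρ exponent)) (sym (ℕ.^-*-assoc s exponent ρ)))) ⟩
    A ℕ.^ exponent ℕ.* (s ℕ.^ exponent) ℕ.^ ρ ℕ.* τ ℕ.^ exponent
      ≤⟨ ℕ.*-monoˡ-≤ (τ ℕ.^ exponent) (ℕ.*-monoʳ-≤ (A ℕ.^ exponent) (ℕ.^-monoˡ-≤ ρ s^p≤m)) ⟩
    A ℕ.^ exponent ℕ.* m ℕ.^ ρ ℕ.* τ ℕ.^ exponent
      ≡⟨ rotate (A ℕ.^ exponent) (m ℕ.^ ρ) (τ ℕ.^ exponent) ⟩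
    m ℕ.^ ρ ℕ.* (A ℕ.^ exponent ℕ.* τ ℕ.^ exponent) ∎)
    where
    open ℕ.≤-Reasoning
    exponents : ∀ ρ → ρ ℕ.+ (3 ℕ.+ ρ) ≡ suc (suc ρ ℕ.+ suc ρ)
    exponents = ℕSolver.solve-∀
    rotate : ∀ a b c → a ℕ.* b ℕ.* c ≡ b ℕ.* (a ℕ.* c)
    rotate = ℕSolver.solve-∀

  surplus-bound : ∀ {n} (G : Graph n) → KFree (2 ℕ.+ ρ) G →
    e G ℕ.^ (3 ℕ.+ ρ) ℕ.≤ bound ℕ.^ exponent ℕ.* (2 ℕ.* mc G ℕ.∸ e G) ℕ.^ exponent
  surplus-bound G free = by-size (1 ℕ.≤? e G) (integer-root (suc ρ ℕ.+ suc ρ) (e G))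
    where
    Goal : Set
    Goal = e G ℕ.^ (3 ℕ.+ ρ) ℕ.≤ bound ℕ.^ exponent ℕ.* (2 ℕ.* mc G ℕ.∸ e G) ℕ.^ exponent
    by-size : Dec (1 ℕ.≤ e G) → (∃ λ s → s ℕ.^ exponent ℕ.≤ e G × e G ℕ.< suc s ℕ.^ exponent) → Goal
    by-size (no e<1) _ = ℕ.≤-trans (ℕ.≤-reflexive (cong (ℕ._^ (3 ℕ.+ ρ)) (ℕ.n<1⇒n≡0 (ℕ.≰⇒> e<1)))) ℕ.z≤n
    by-size (yes 1≤e) (zero , _ , e<1) = ⊥-elim (ℕ.<⇒≱ e<1 (subst (ℕ._≤ e G) (sym (ℕ.^-zeroˡ exponent)) 1≤e))
    by-size (yes 1≤e) (suc s , s^p≤e , e<S) =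
      power-bound bound (e G) (suc s) (2 ℕ.* mc G ℕ.∸ e G) 1≤e s^p≤e (edges-bound G (suc s) (ℕ.s≤s ℕ.z≤n) e<S free)

-- Since 1/2 + 3/(4r-2) = (r+1)/(2r-1) and 2 mc(G) - e(G) = 2 sp(G), raising the claim to the power
-- 2r-1 gives this integral form, with N absorbing c_r and the factor 2. Truncation is harmless: if
-- e(G) > 0, the inequality itself makes the difference positive.
theorem1p7 : (r : ℕ) → 3 ℕ.≤ r →
    Σ ℕ (λ N → 1 ℕ.≤ N ×
    ((n : ℕ) (G : Graph n) → KFree r G →
    e G ℕ.^ (r ℕ.+ 1) ℕ.≤ N ℕ.* (2 ℕ.* mc G ℕ.∸ e G) ℕ.^ (2 ℕ.* r ℕ.∸ 1)))
theorem1p7 (suc (suc ρ)) _ = suc N , ℕ.s≤s ℕ.z≤n , λ n G free →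
  subst₂ (λ i j → e G ℕ.^ i ℕ.≤ suc N ℕ.* (2 ℕ.* mc G ℕ.∸ e G) ℕ.^ j) (r+1 ρ) (2r-1 ρ)
    (ℕ.≤-trans (surplus-bound ρ G free) (ℕ.*-monoˡ-≤ ((2 ℕ.* mc G ℕ.∸ e G) ℕ.^ exponent ρ) (ℕ.n≤1+n N)))
  where
  N : ℕ
  N = bound ρ ℕ.^ exponent ρ
  r+1 : ∀ ρ → 3 ℕ.+ ρ ≡ 2 ℕ.+ ρ ℕ.+ 1
  r+1 = ℕSolver.solve-∀
  2r-1 : ∀ ρ → exponent ρ ≡ 2 ℕ.* (2 ℕ.+ ρ) ℕ.∸ 1
  2r-1 ρ = sym (cong suc (trans (cong (ρ ℕ.+_) (cong (λ z → suc (suc z)) (ℕ.+-identityʳ ρ))) (ℕ.+-suc ρ (suc ρ))))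
theorem1p7 zero ()
theorem1p7 (suc zero) (ℕ.s≤s ())
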